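{- Let $k\ge 1$ and $P\ge 1$ be integers, let $l_1,\dots,l_k$ be nonnegative integers, and let $b>0$, $c>0$ be integers. Let $G_P=C_P(l_1,\dots,l_k)$ be the circulant (multi)graph on $\mathbb{Z}/P\mathbb{Z}$ and let $\tilde S_P(x)$ be the polynomial, both defined in the context. 1) If the graph $G_P$ has a perfect $2$-colouring with parameters $(b,c)$, then $\tilde S_P(1)$ is divisible by $\frac{b+c}{\gcd(b,c)}$. 2) If $P=q^t$ for some prime number $q$ and integer $t>0$, then the graph $G_P$ has a perfect $2$-colouring with parameters $(b,c)$ if and only if $\tilde S_P(1)$ is divisible by $\frac{b+c}{\gcd(b,c)}$.
   Context: Graphs may have loops and multiple edges. $C_\infty(l_1,\dots,l_k)$ is the graph with vertex set $\mathbb{Z}$ in which numbers differing by $l_i$, for some $i$, are joined by an edge; it is $2k$-regular, the neighbours of a vertex $g$, counted with multiplicity, being $g+l_i$ and $g-l_i$ for $i=1,\dots,k$. $C_P(l_1,\dots,l_k)$ is the graph on $P$ vertices obtained from $C_\infty(l_1,\dots,l_k)$ by reducing vertices modulo $P$: its vertex set is $\mathbb{Z}/P\mathbb{Z}$ and the neighbours of $g$, counted with multiplicity, are the $2k$ elements $g+l_i$, $g-l_i$ ($i=1,\dots,k$) modulo $P$. A perfect $2$-colouring with parameters $(b,c)$ of a regular graph is a colouring of its vertices in two colours (black and white) such that each black vertex has exactly $b$ white neighbours and each white vertex has exactly $c$ black neighbours (neighbours counted with multiplicity). $\Phi_n(x)$ denotes the $n$-th cyclotomic polynomial. Put $M=\max(l_1,\dots,l_k)$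 and $$A(x)=x^M\Big(b+c-2k+\sum_{i=1}^k (x^{l_i}+x^{ -l_i})\Big)\in\mathbb{Z}[x],$$ $$\tilde S_P(x)=\prod_{n:\; n\mid P,\ \Phi_n(x)\mid A(x),\ n \text{ is a prime power}}\Phi_n(x),$$ where a prime power means $p^j$ with $p$ prime and $j\ge 1$; an empty product is $1$. -}

module Defs where

open import Data.Nat as ℕ using (ℕ; zero; suc; _≤_; _<_; z≤n; s≤s; NonZero; _⊔_; _∸_)
open import Data.Nat.Properties as ℕₚ using (anyUpTo?)
import Data.Nat.Divisibility as ℕ∣
open import Data.Nat.DivMod using (_/_)
open import Data.Nat.GCD using (gcd; gcd[m,n]≢0)
open import Data.Nat.Primality using (Prime; prime?; prime⇒nonTrivial)
open import Data.Integer as ℤ using (ℤ; +_; 0ℤ; 1ℤ; -1ℤ)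
import Data.Integer.Properties as ℤₚ
open import Data.Integer.DivMod using (_%ℕ_; n%ℕd<d)
import Data.Integer.Divisibility.Signed as ℤ∣
open import Data.Fin using (Fin; toℕ; fromℕ<)
open import Data.List using (List; []; _∷_; _++_; map; foldr; filter; length; replicate; upTo; concatMap)
open import Data.Vec as Vec using (Vec; toList)
open import Data.Product using (∃-syntax; _×_; _,_)
open import Data.Sum using (_⊎_; inj₁; inj₂)
open import Function using (_∘_)
open import Relation.Nullary using (Dec; yes; no; contradiction)
open import Relation.Nullary.Decidable using (_×-dec_; map′)
open import Relation.Binary.PropositionalEquality
  using (_≡_; _≢_; refl; sym; trans; cong; cong₂; subst; module ≡-Reasoning)

-- Polynomials over ℤ: coefficient lists, constant term first.  Trailing zeros
-- are allowed, so equality of polynomials is _≈_ rather than _≡_.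

Poly : Set
Poly = List ℤ

coeff : Poly → ℕ → ℤ
coeff []      _       = 0ℤ
coeff (a ∷ f) zero    = a
coeff (a ∷ f) (suc i) = coeff f i

infix 4 _≈_ _∣ₚ_ _∣ₚ?_
infixl 6 _+ₚ_ _-ₚ_
infixl 7 _*ₚ_ _·ₚ_

_≈_ : Poly → Poly → Set
f ≈ g = ∀ i → coeff f i ≡ coeff g i

_+ₚ_ : Poly → Poly → Poly
[]      +ₚ g       = g
(a ∷ f) +ₚ []      = a ∷ f
(a ∷ f) +ₚ (b ∷ g) = (a ℤ.+ b) ∷ (f +ₚ g)

_·ₚ_ : ℤ → Poly → Poly
c ·ₚ f = map (c ℤ.*_) f

_-ₚ_ : Poly → Poly → Poly
f -ₚ g = f +ₚ (-1ℤ ·ₚ g)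

_*ₚ_ : Poly → Poly → Poly
[]      *ₚ g = []
(a ∷ f) *ₚ g = (a ·ₚ g) +ₚ (0ℤ ∷ (f *ₚ g))

1ₚ : Poly
1ₚ = 1ℤ ∷ []

x^_ : ℕ → Poly
x^ n = replicate n 0ℤ ++ 1ₚ

∑ₚ ∏ₚ : List Poly → Poly
∑ₚ = foldr _+ₚ_ []
∏ₚ = foldr _*ₚ_ 1ₚ

eval : Poly → ℤ → ℤ
eval []      x = 0ℤ
eval (a ∷ f) x = a ℤ.+ x ℤ.* eval f x

_∣ₚ_ : Poly → Poly → Set
g ∣ₚ f = ∃[ q ] f ≈ q *ₚ g

-- Divisibility in ℤ[x] is decidable.  After cancelling powers of x from the
-- divisor, the quotient is determined from its constant term upwards, and its
-- degree is bounded by that of the dividend.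

coeff-+ : ∀ f g i → coeff (f +ₚ g) i ≡ coeff f i ℤ.+ coeff g i
coeff-+ []      g       i       = sym (ℤₚ.+-identityˡ _)
coeff-+ (a ∷ f) []      i       = sym (ℤₚ.+-identityʳ _)
coeff-+ (a ∷ f) (b ∷ g) zero    = refl
coeff-+ (a ∷ f) (b ∷ g) (suc i) = coeff-+ f g i

coeff-· : ∀ c f i → coeff (c ·ₚ f) i ≡ c ℤ.* coeff f i
coeff-· c []      i       = sym (ℤₚ.*-zeroʳ c)
coeff-· c (a ∷ f) zero    = refl
coeff-· c (a ∷ f) (suc i) = coeff-· c f i

coeff-- : ∀ f g i → coeff (f -ₚ g) i ≡ coeff f i ℤ.- coeff g i
coeff-- f g i = trans (coeff-+ f _ i)
  (cong (ℤ._+_ (coeff f i)) (trans (coeff-· -1ℤ g i) (ℤₚ.-1*i≡-i _)))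

coeff-* : ∀ a f g i →
  coeff ((a ∷ f) *ₚ g) i ≡ a ℤ.* coeff g i ℤ.+ coeff (0ℤ ∷ (f *ₚ g)) i
coeff-* a f g i = trans (coeff-+ (a ·ₚ g) _ i) (cong (ℤ._+ _) (coeff-· a g i))

coeff-beyond : ∀ f i → length f ≤ i → coeff f i ≡ 0ℤ
coeff-beyond []      i       _       = refl
coeff-beyond (a ∷ f) (suc i) (s≤s p) = coeff-beyond f i p

-- VanishesFrom n f says that f has degree less than n.
VanishesFrom : ℕ → Poly → Set
VanishesFrom n f = ∀ i → n ≤ i → coeff f i ≡ 0ℤ

0*ₚ : ∀ q g → VanishesFrom 0 q → VanishesFrom 0 (q *ₚ g)
0*ₚ []      g z i p = refl
0*ₚ (a ∷ q) g z i p = trans (coeff-* a q g i)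
  (trans (cong₂ ℤ._+_ (trans (cong (ℤ._* coeff g i) (z 0 z≤n)) (ℤₚ.*-zeroˡ (coeff g i))) (tail0 i))
         (ℤₚ.+-identityˡ 0ℤ))
  where
  tail0 : ∀ j → coeff (0ℤ ∷ (q *ₚ g)) j ≡ 0ℤ
  tail0 zero    = refl
  tail0 (suc j) = 0*ₚ q g (λ k _ → z (suc k) z≤n) j z≤n

top-coeff-* : ∀ q g m n → VanishesFrom (suc m) q → VanishesFrom (suc n) g →
  coeff (q *ₚ g) (m ℕ.+ n) ≡ coeff q m ℤ.* coeff g n
top-coeff-* []      g m       n hq hg = sym (ℤₚ.*-zeroˡ (coeff g n))
top-coeff-* (a ∷ q) g zero    n hq hg = trans (coeff-* a q g n)
  (trans (cong (ℤ._+_ (a ℤ.* coeff g n)) (tail0 n)) (ℤₚ.+-identityʳ _))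
  where
  tail0 : ∀ j → coeff (0ℤ ∷ (q *ₚ g)) j ≡ 0ℤ
  tail0 zero    = refl
  tail0 (suc j) = 0*ₚ q g (λ k _ → hq (suc k) (s≤s z≤n)) j z≤n
top-coeff-* (a ∷ q) g (suc m) n hq hg = trans (coeff-* a q g (suc (m ℕ.+ n)))
  (trans (cong₂ ℤ._+_
           (trans (cong (a ℤ.*_) (hg _ (s≤s (ℕₚ.m≤n+m n m)))) (ℤₚ.*-zeroʳ a))
           (top-coeff-* q g m n (λ i p → hq (suc i) (s≤s p)) hg))
         (ℤₚ.+-identityˡ _))

degree : ∀ f → VanishesFrom 0 f ⊎ ∃[ n ] (coeff f n ≢ 0ℤ × VanishesFrom (suc n) f)
degree [] = inj₁ λ _ _ → refl
degree (a ∷ f) with degree f | a ℤ.≟ 0ℤ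
... | inj₂ (n , nz , v) | _      = inj₂ (suc n , nz , λ { (suc i) (s≤s p) → v i p })
... | inj₁ v            | yes a0 = inj₁ λ { zero _ → a0 ; (suc i) _ → v i z≤n }
... | inj₁ v            | no a≢0 = inj₂ (0 , a≢0 , λ { (suc i) _ → v i z≤n })

quotient-bound : ∀ f q g → coeff g 0 ≢ 0ℤ → f ≈ q *ₚ g → VanishesFrom (length f) q
quotient-bound f q g g0≢0 eq with degree q | degree g
... | inj₁ v            | _                  = λ i _ → v i z≤n
... | inj₂ _            | inj₁ v             = contradiction (v 0 z≤n) g0≢0
... | inj₂ (m , mnz , mv) | inj₂ (n , nnz , nv) =
  λ i p → mv i (ℕₚ.≤-trans (ℕₚ.≤-trans (s≤s (ℕₚ.m≤m+n m n)) m+n<) p)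
  where
  top≢0 : coeff f (m ℕ.+ n) ≢ 0ℤ
  top≢0 e with ℤₚ.i*j≡0⇒i≡0∨j≡0 (coeff q m)
                 (trans (sym (top-coeff-* q g m n mv nv)) (trans (sym (eq (m ℕ.+ n))) e))
  ... | inj₁ e′ = mnz e′
  ... | inj₂ e′ = nnz e′
  m+n< : m ℕ.+ n < length f
  m+n< = ℕₚ.≰⇒> (top≢0 ∘ coeff-beyond f (m ℕ.+ n))

≈0? : ∀ f → Dec (VanishesFrom 0 f)
≈0? f with degree f
... | inj₁ v            = yes v
... | inj₂ (n , nz , _) = no λ v → nz (v n z≤n)

tailₚ : Poly → Poly
tailₚ []      = []
tailₚ (_ ∷ f) = f

coeff-tail : ∀ f i → coeff (tailₚ f) i ≡ coeff f (suc i)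
coeff-tail []      i = refl
coeff-tail (_ ∷ f) i = refl

0∷*ₚ : ∀ q g → (q *ₚ (0ℤ ∷ g)) ≈ (0ℤ ∷ (q *ₚ g))
0∷*ₚ []      g zero    = refl
0∷*ₚ []      g (suc i) = refl
0∷*ₚ (a ∷ q) g zero    = trans (ℤₚ.+-identityʳ _) (ℤₚ.*-zeroʳ a)
0∷*ₚ (a ∷ q) g (suc i) = begin
  coeff ((a ·ₚ g) +ₚ (q *ₚ (0ℤ ∷ g))) i            ≡⟨ coeff-+ (a ·ₚ g) _ i ⟩
  coeff (a ·ₚ g) i ℤ.+ coeff (q *ₚ (0ℤ ∷ g)) i     ≡⟨ cong (ℤ._+_ (coeff (a ·ₚ g) i)) (0∷*ₚ q g i) ⟩
  coeff (a ·ₚ g) i ℤ.+ coeff (0ℤ ∷ (q *ₚ g)) i     ≡⟨ coeff-+ (a ·ₚ g) _ i ⟨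
  coeff ((a ·ₚ g) +ₚ (0ℤ ∷ (q *ₚ g))) i            ∎
  where open ≡-Reasoning

module _ (b : ℤ) (g : Poly) (b≢0 : b ≢ 0ℤ) where

  private
    instance
      b-nonZero : ℤ.NonZero b
      b-nonZero = ℤ.≢-nonZero b≢0

    Quotient : ℕ → Poly → Set
    Quotient n f = ∃[ q ] (VanishesFrom n q × f ≈ q *ₚ (b ∷ g))

    step : ∀ {n} f q₀ → coeff f 0 ≡ q₀ ℤ.* b →
           Quotient n (tailₚ f -ₚ (q₀ ·ₚ g)) → Quotient (suc n) f
    step f q₀ e (q , v , h) = q₀ ∷ q , (λ { (suc i) (s≤s p) → v i p }) , λ where
        zero    → trans e (sym (ℤₚ.+-identityʳ _))
        (suc i) → begin
          coeff f (suc i)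
            ≡⟨ coeff-tail f i ⟨
          coeff (tailₚ f) i
            ≡⟨ rearrange (coeff (tailₚ f) i) (coeff (q₀ ·ₚ g) i) ⟨
          coeff (q₀ ·ₚ g) i ℤ.+ (coeff (tailₚ f) i ℤ.- coeff (q₀ ·ₚ g) i)
            ≡⟨ cong (ℤ._+_ (coeff (q₀ ·ₚ g) i)) (trans (sym (coeff-- (tailₚ f) (q₀ ·ₚ g) i)) (h i)) ⟩
          coeff (q₀ ·ₚ g) i ℤ.+ coeff (q *ₚ (b ∷ g)) i
            ≡⟨ coeff-+ (q₀ ·ₚ g) _ i ⟨
          coeff ((q₀ ·ₚ g) +ₚ (q *ₚ (b ∷ g))) i ∎
      where
      open ≡-Reasoning
      rearrange : ∀ s t → t ℤ.+ (s ℤ.- t) ≡ s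
      rearrange s t = trans (ℤₚ.+-comm t _) (trans (ℤₚ.+-assoc s (ℤ.- t) t)
        (trans (cong (ℤ._+_ s) (ℤₚ.+-inverseˡ t)) (ℤₚ.+-identityʳ s)))

    unstep-∷ : ∀ {n} f q₀ a q → VanishesFrom (suc n) (a ∷ q) → coeff f 0 ≡ q₀ ℤ.* b →
               f ≈ (a ∷ q) *ₚ (b ∷ g) → Quotient n (tailₚ f -ₚ (q₀ ·ₚ g))
    unstep-∷ f q₀ a q v e h = q , (λ i p → v (suc i) (s≤s p)) , λ i → begin
        coeff (tailₚ f -ₚ (q₀ ·ₚ g)) i
          ≡⟨ coeff-- (tailₚ f) (q₀ ·ₚ g) i ⟩
        coeff (tailₚ f) i ℤ.- coeff (q₀ ·ₚ g) i
          ≡⟨ cong (ℤ._- _) (trans (coeff-tail f i) (trans (h (suc i)) (coeff-+ (a ·ₚ g) _ i))) ⟩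
        coeff (a ·ₚ g) i ℤ.+ coeff (q *ₚ (b ∷ g)) i ℤ.- coeff (q₀ ·ₚ g) i
          ≡⟨ cong (λ c → coeff (c ·ₚ g) i ℤ.+ coeff (q *ₚ (b ∷ g)) i ℤ.- coeff (q₀ ·ₚ g) i) a≡q₀ ⟩
        coeff (q₀ ·ₚ g) i ℤ.+ coeff (q *ₚ (b ∷ g)) i ℤ.- coeff (q₀ ·ₚ g) i
          ≡⟨ rearrange (coeff (q₀ ·ₚ g) i) _ ⟩
        coeff (q *ₚ (b ∷ g)) i ∎
      where
      open ≡-Reasoning
      a≡q₀ : a ≡ q₀
      a≡q₀ = ℤₚ.*-cancelʳ-≡ a q₀ b
        (trans (sym (ℤₚ.+-identityʳ _)) (trans (sym (h 0)) e))
      rearrange : ∀ s t → s ℤ.+ t ℤ.- s ≡ t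
      rearrange s t = trans (cong (ℤ._- s) (ℤₚ.+-comm s t)) (trans (ℤₚ.+-assoc t s (ℤ.- s))
        (trans (cong (ℤ._+_ t) (ℤₚ.+-inverseʳ s)) (ℤₚ.+-identityʳ t)))

    unstep : ∀ {n} f q₀ → coeff f 0 ≡ q₀ ℤ.* b →
             Quotient (suc n) f → Quotient n (tailₚ f -ₚ (q₀ ·ₚ g))
    unstep f q₀ e (a ∷ q , v , h) = unstep-∷ f q₀ a q v e h
    unstep f q₀ e ([]    , v , h) = unstep-∷ f q₀ 0ℤ [] (λ { (suc _) _ → refl }) e λ i →
      trans (h i) (sym (0*ₚ (0ℤ ∷ []) (b ∷ g) (λ { zero _ → refl ; (suc _) _ → refl }) i z≤n))

    constant-∣ : ∀ {n} f → Quotient n f → b ℤ∣.∣ coeff f 0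
    constant-∣ f ([]    , v , h) = ℤ∣.divides 0ℤ (trans (h 0) (sym (ℤₚ.*-zeroˡ b)))
    constant-∣ f (a ∷ q , v , h) = ℤ∣.divides a (trans (h 0) (ℤₚ.+-identityʳ _))

    quotient? : ∀ n f → Dec (Quotient n f)
    quotient? zero f = map′
      (λ z → [] , (λ _ _ → refl) , λ i → z i z≤n)
      (λ { (q , v , h) i p → trans (h i) (0*ₚ q (b ∷ g) v i p) })
      (≈0? f)
    quotient? (suc n) f with b ℤ∣.∣? coeff f 0
    ... | no ∤                   = no (∤ ∘ constant-∣ f)
    ... | yes (ℤ∣.divides q₀ e) =
      map′ (step f q₀ e) (unstep f q₀ e) (quotient? n (tailₚ f -ₚ (q₀ ·ₚ g)))

  ∣ₚ?-nonzero-constant : ∀ f → Dec ((b ∷ g) ∣ₚ f)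
  ∣ₚ?-nonzero-constant f = map′
    (λ { (q , _ , h) → q , h })
    (λ { (q , h) → q , quotient-bound f q (b ∷ g) b≢0 h , h })
    (quotient? (length f) f)

_∣ₚ?_ : ∀ g f → Dec (g ∣ₚ f)
[] ∣ₚ? f = map′
  (λ z → [] , λ i → z i z≤n)
  (λ { (q , h) i p → trans (h i) (*ₚ-zeroʳ q i) })
  (≈0? f)
  where
  *ₚ-zeroʳ : ∀ q i → coeff (q *ₚ []) i ≡ 0ℤ
  *ₚ-zeroʳ []      i       = refl
  *ₚ-zeroʳ (_ ∷ q) zero    = refl
  *ₚ-zeroʳ (_ ∷ q) (suc i) = *ₚ-zeroʳ q i
(b ∷ g) ∣ₚ? f with b ℤ.≟ 0ℤ
... | no b≢0 = ∣ₚ?-nonzero-constant b g b≢0 f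
... | yes refl = map′
  (λ { (e , q , h) → q , λ where
         zero    → trans e (sym (0∷*ₚ q g 0))
         (suc i) → trans (sym (coeff-tail f i)) (trans (h i) (sym (0∷*ₚ q g (suc i)))) })
  (λ { (q , h) → trans (h 0) (0∷*ₚ q g 0) , q , λ i →
         trans (coeff-tail f i) (trans (h (suc i)) (0∷*ₚ q g (suc i))) })
  ((coeff f 0 ℤ.≟ 0ℤ) ×-dec (g ∣ₚ? tailₚ f))

-- f ÷ g is the quotient when g divides f, and 0 otherwise.
_÷_ : Poly → Poly → Poly
f ÷ g with g ∣ₚ? f
... | yes (q , _) = q
... | no  _       = []

-- Cyclotomic polynomials, by x^n - 1 = ∏_{d ∣ n} Φ_d, that is
-- Φ_n = (x^n - 1) / ∏_{d ∣ n, d < n} Φ_d, where the division is exact.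
-- Φ≤ N d is Φ_d for 1 ≤ d ≤ N; the indices d = 0 and d > N carry the junk value 1.

Φ≤ : ℕ → ℕ → Poly
Φ≤ zero    d = 1ₚ
Φ≤ (suc N) d with d ℕ.≟ suc N
... | no  _ = Φ≤ N d
... | yes _ = (x^ d -ₚ 1ₚ) ÷ ∏ₚ (map (Φ≤ N) (filter (ℕ∣._∣? d) (upTo d)))

Φ : ℕ → Poly
Φ n = Φ≤ n n

PrimePower : ℕ → Set
PrimePower n = ∃[ p ] ∃[ j ] (Prime p × 1 ≤ j × n ≡ p ℕ.^ j)

m<n^m : ∀ n m → 1 < n → m < n ℕ.^ m
m<n^m n zero    1<n = s≤s z≤n
m<n^m n (suc m) 1<n = ℕₚ.≤-<-trans (m<n^m n m 1<n)
  (ℕₚ.^-monoʳ-< n 1<n (ℕₚ.n<1+n m))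

primePower? : ∀ n → Dec (PrimePower n)
primePower? n = map′ forget bound
  (anyUpTo? (λ p → anyUpTo? (λ j → prime? p ×-dec (1 ℕ.≤? j) ×-dec (n ℕ.≟ p ℕ.^ j)) (suc n)) (suc n))
  where
  Bounded = ∃[ p ] (p < suc n × ∃[ j ] (j < suc n × (Prime p × 1 ≤ j × n ≡ p ℕ.^ j)))
  forget : Bounded → PrimePower n
  forget (p , _ , j , _ , h) = p , j , h
  bound : PrimePower n → Bounded
  bound (p , j , pp , 1≤j , refl) =
    p , s≤s p≤p^j , j , s≤s (ℕₚ.<⇒≤ (m<n^m p j 1<p)) , pp , 1≤j , refl
    where
    1<p : 1 < p
    1<p = ℕ.nonTrivial⇒n>1 p {{prime⇒nonTrivial pp}}
    p≤p^j : p ≤ p ℕ.^ j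
    p≤p^j = subst (_≤ p ℕ.^ j) (ℕₚ.^-identityʳ p)
      (ℕₚ.^-monoʳ-≤ p {{ℕ.>-nonZero (ℕₚ.<-trans (s≤s z≤n) 1<p)}} 1≤j)

-- The multiplicity of w in the list of v is the number of edges joining v to w.
Neighbours : Set → Set
Neighbours V = V → List V

C∞ : ∀ {k} → Vec ℕ k → Neighbours ℤ
C∞ l g = concatMap (λ lᵢ → (g ℤ.+ + lᵢ) ∷ (g ℤ.- + lᵢ) ∷ []) (toList l)

_modFin_ : ℤ → (P : ℕ) .{{_ : NonZero P}} → Fin P
z modFin P = fromℕ< (n%ℕd<d z P)

C : ∀ {k} (P : ℕ) .{{_ : NonZero P}} → Vec ℕ k → Neighbours (Fin P)
C P l g = map (_modFin P) (C∞ l (+ toℕ g))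

data Colour : Set where
  black white : Colour

_≟ᶜ_ : (x y : Colour) → Dec (x ≡ y)
black ≟ᶜ black = yes refl
black ≟ᶜ white = no λ ()
white ≟ᶜ black = no λ ()
white ≟ᶜ white = yes refl

module _ {V : Set} (G : Neighbours V) where

  #neighbours : (V → Colour) → Colour → V → ℕ
  #neighbours col x v = length (filter (λ w → col w ≟ᶜ x) (G v))

  record IsPerfectColouring (b c : ℕ) (col : V → Colour) : Set where
    field
      black-vertices : ∀ v → col v ≡ black → #neighbours col white v ≡ b
      white-vertices : ∀ v → col v ≡ white → #neighbours col black v ≡ c

  HasPerfectColouring : (b c : ℕ) → Set
  HasPerfectColouring b c = ∃[ col ] IsPerfectColouring b c col

maxᵥ : ∀ {k} → Vec ℕ k → ℕ
maxᵥ = Vec.foldr′ _⊔_ 0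

-- The factor x^M is multiplied into the bracket: since l_i ≤ M, the truncated
-- subtraction M ∸ l_i is exact and x^M x^(-l_i) = x^(M ∸ l_i).
A : ∀ {k} → Vec ℕ k → (b c : ℕ) → Poly
A {k} l b c =
  ((+ b ℤ.+ + c ℤ.- + (2 ℕ.* k)) ·ₚ x^ M)
    +ₚ ∑ₚ (map (λ lᵢ → x^ (M ℕ.+ lᵢ) +ₚ x^ (M ∸ lᵢ)) (toList l))
  where M = maxᵥ l

S̃ : ∀ {k} → ℕ → Vec ℕ k → (b c : ℕ) → Poly
S̃ P l b c = ∏ₚ (map Φ (filter
  (λ n → (n ℕ∣.∣? P) ×-dec (Φ n ∣ₚ? A l b c) ×-dec primePower? n)
  (upTo (suc P))))

[_+_]/gcd : (b c : ℕ) .{{_ : NonZero b}} → ℕ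
[ b + c ]/gcd = ((b ℕ.+ c) / gcd b c)
  {{ℕ.≢-nonZero (gcd[m,n]≢0 b c (inj₁ (ℕ.≢-nonZero⁻¹ b)))}}

{-# OPTIONS --safe #-}

-- ℤ[x] acts on integer sequences, x being the shift.  A 2-colouring is perfect with parameters
-- (b, c) exactly if the indicator u of the black vertices satisfies A ⋆ u = c.
--
-- Necessity.  Put F = ∑ u(i) x^(P-1-i), so that A F = c (x^P - 1)/(x - 1) modulo x^P - 1 and
-- (b + c) F(1) = c P.  For every prime power n ∣ P the polynomial Φ_n divides A F, and it is a
-- prime element of ℤ[x].  Hence the product of the Φ_n that do not divide A divides F; at x = 1
-- all these Φ_n together are a multiple of P, which leaves (b + c) ∣ c S̃_P(1).
--
-- Sufficiency for P = q^t.  S̃_P is a product of factors 1 + y + … + y^(q-1) with y = x^(q^j), one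
-- for each j in some set J.  Label n by the number N(n) < s = S̃_P(1) formed from the base-q
-- digits of n at the positions in J.  The exponents of S̃_P, translated by any n, meet every label
-- once, carries notwithstanding.  So if {N < K} is black then S̃_P ⋆ u = K, and A ⋆ u is the
-- constant K (b + c) / s, which is c for K = c s / (b + c).
module Submission where

open import Defs
open import Algebra.Bundles using (CommutativeRing)
import Algebra.Consequences.Setoid as Consequences
open import Data.Fin as Fin using (Fin; toℕ; inject₁; fromℕ)
import Data.Fin.Properties as Finₚ
open import Data.Integer as ℤ using (ℤ; +_; 0ℤ; 1ℤ; -1ℤ)
open import Data.Integer.DivMod using (_%ℕ_; _/ℕ_; n%ℕd<d; a≡a%ℕn+[a/ℕn]*n)
open import Data.Integer.Divisibility using (_∣_)
import Data.Integer.Divisibility.Signed as ℤ∣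
import Data.Integer.Properties as ℤₚ
open import Data.Integer.Tactic.RingSolver using (solve-∀)
open import Data.List using (List; []; _∷_; _++_; map; filter; length; concatMap; foldr; upTo; downFrom)
open import Data.List.Membership.Propositional using (_∈_)
open import Data.List.Membership.Propositional.Properties
  using (∈-filter⁺; ∈-filter⁻; ∈-upTo⁺; ∈-upTo⁻; ∈-downFrom⁺; ∈-downFrom⁻; ∈-map∘filter⁺; ∈-map∘filter⁻;
         ∈-∃++; ∈-++⁺ˡ; ∈-++⁺ʳ; ∈-++⁻; ∈-map⁻)
open import Data.List.Membership.Propositional.Properties.WithK using (unique∧set⇒bag)
open import Data.List.Properties
  using (filter-accept; filter-all; filter-reject; length-map; map-∘; map-++; map-cong-local)
open import Data.List.Relation.Binary.BagAndSetEquality using (∼bag⇒↭)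
open import Data.List.Relation.Binary.Permutation.Propositional as ↭ using (_↭_)
import Data.List.Relation.Binary.Permutation.Propositional.Properties as ↭ₚ
open import Data.List.Relation.Binary.Subset.Propositional using (_⊆_)
open import Data.List.Relation.Unary.All as All using (All; []; _∷_)
open import Data.List.Relation.Unary.AllPairs using ([]; _∷_)
open import Data.List.Relation.Unary.Any using (here; there)
open import Data.List.Relation.Unary.Unique.Propositional using (Unique)
import Data.List.Relation.Unary.Unique.Propositional.Properties as Uniqueₚ
open import Data.Maybe using (Maybe; just; nothing)
open import Data.Nat as ℕ using (ℕ; zero; suc; _≤_; _<_; z≤n; s≤s; NonZero; _∸_; _!; _>_; _^_)
open import Data.Nat.Combinatorics using (k![n∸k]!∣n!; nCk≡n!/k![n-k]!; nCn≡1) renaming (_C_ to infixl 8 _choose_)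
open import Data.Nat.Coprimality using (Coprime; coprime-+; coprime-/gcd; coprime-divisor)
import Data.Nat.Divisibility as ℕ∣
open import Data.Nat.DivMod as ℕ/ using (m/n*n≡m; m*n/n≡m; m<n⇒m%n≡m; m≡m%n+[m/n]*n; [m+n]%n≡m%n)
open import Data.Nat.GCD using (gcd; gcd[m,n]∣m; gcd[m,n]∣n; gcd-greatest; gcd[m,n]≢0)
open import Data.Nat.Induction using (<-rec)
open import Data.Nat.Primality using (Prime; euclidsLemma; prime⇒nonTrivial; prime⇒nonZero; prime⇒irreducible)
open import Data.Nat.Primality.Factorisation using (factorise)
import Data.Nat.Properties as ℕₚ
open import Data.Product using (_,_; _×_; ∃-syntax; proj₁; proj₂)
open import Data.Sum as Sum using (_⊎_; inj₁; inj₂)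
open import Data.Vec using (Vec; []; _∷_; toList)
open import Data.Vec.Functional as Vector using (Vector)
open import Function using (_∘_; mk⇔)
open import Function.Bundles using (_⇔_)
open import Level using (0ℓ)
open import Relation.Binary.Bundles using (Setoid)
open import Relation.Binary.Definitions using (tri<; tri≈; tri>)
open import Relation.Binary.PropositionalEquality
open import Relation.Binary.Structures using (IsEquivalence)
open import Relation.Nullary using (¬_; Dec; yes; no; contradiction; ¬?)
open import Relation.Nullary.Decidable using (_×-dec_)
open import Relation.Unary using (Pred; Decidable)
open import Tactic.RingSolver.Core.AlmostCommutativeRing using (fromCommutativeRing)
import Tactic.RingSolver.NonReflective as Solver

import Algebra.Properties.AbelianGroup ℤₚ.+-0-abelianGroup as ℤ-group

-- The ring ℤ[x] and its action on sequences

-- Prime powers are singled out by evaluation at 1, where all counting takes place: `A` has the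
-- value `b + c` there, and `F` the number of black vertices. For n > 1 the value of Φ_n at 1 is p
-- if n is a power of a prime p, and 1 otherwise, so the remaining Φ_n carry no arithmetic
-- information. The divisibilities of `F` have to be combined in ℤ[x], because the cofactor must
-- have an integer value at 1. Unique factorisation is replaced by two facts: each of these Φ_n is
-- prime, and none divides another. Primality does not pass through irreducibility over ℚ; it rests
-- on p being totally ramified at x = 1, that is, on the value p at 1 and on the membership of some
-- power of x - 1 in the ideal (p, Φ_n). The factor c in (b + c) ∣ c S̃_P(1) disappears because (b +
-- c)/gcd(b, c) is coprime to c/gcd(b, c). The same divisibility makes the threshold K an integer in
-- the converse.

Sequence : Set
Sequence = ℕ → ℤ

infixr 7 _⋆_

-- ℤ[x] acts on sequences, x being the shift.  The action is faithful, so the ring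
-- laws of ℤ[x] follow from the composition laws of the operators f ⋆_.
_⋆_ : Poly → Sequence → Sequence
([]      ⋆ u) n = 0ℤ
((a ∷ f) ⋆ u) n = a ℤ.* u n ℤ.+ (f ⋆ u) (suc n)

⋆-vanishing : ∀ f → VanishesFrom 0 f → ∀ u n → (f ⋆ u) n ≡ 0ℤ
⋆-vanishing []      z u n = refl
⋆-vanishing (a ∷ f) z u n
  rewrite z 0 z≤n | ⋆-vanishing f (λ i _ → z (suc i) z≤n) u (suc n) = trans (ℤₚ.+-identityʳ _) (ℤₚ.*-zeroˡ (u n))

⋆-congˡ : ∀ f g → f ≈ g → ∀ u n → (f ⋆ u) n ≡ (g ⋆ u) n
⋆-congˡ []      g       e u n = sym (⋆-vanishing g (λ i _ → sym (e i)) u n)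
⋆-congˡ (a ∷ f) []      e u n = ⋆-vanishing (a ∷ f) (λ i _ → e i) u n
⋆-congˡ (a ∷ f) (b ∷ g) e u n =
  cong₂ ℤ._+_ (cong (ℤ._* u n) (e 0)) (⋆-congˡ f g (e ∘ suc) u (suc n))

⋆-congʳ : ∀ f {u v : Sequence} → u ≗ v → f ⋆ u ≗ f ⋆ v
⋆-congʳ []      e n = refl
⋆-congʳ (a ∷ f) e n = cong₂ ℤ._+_ (cong (a ℤ.*_) (e n)) (⋆-congʳ f e (suc n))

+-⋆ : ∀ f g u n → ((f +ₚ g) ⋆ u) n ≡ (f ⋆ u) n ℤ.+ (g ⋆ u) n
+-⋆ []      g       u n = sym (ℤₚ.+-identityˡ _)
+-⋆ (a ∷ f) []      u n = sym (ℤₚ.+-identityʳ _)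
+-⋆ (a ∷ f) (b ∷ g) u n rewrite +-⋆ f g u (suc n) = eq a b (u n) _ _
  where
  eq : ∀ a b x s t → (a ℤ.+ b) ℤ.* x ℤ.+ (s ℤ.+ t) ≡ (a ℤ.* x ℤ.+ s) ℤ.+ (b ℤ.* x ℤ.+ t)
  eq = solve-∀

·-⋆ : ∀ c f u n → ((c ·ₚ f) ⋆ u) n ≡ c ℤ.* (f ⋆ u) n
·-⋆ c []      u n = sym (ℤₚ.*-zeroʳ c)
·-⋆ c (a ∷ f) u n rewrite ·-⋆ c f u (suc n) = eq c a (u n) _
  where
  eq : ∀ c a x s → c ℤ.* a ℤ.* x ℤ.+ c ℤ.* s ≡ c ℤ.* (a ℤ.* x ℤ.+ s)
  eq = solve-∀

-- The combination `c u + v` is the shape of `(a ∷ f) ⋆ u`, with the shifted `f ⋆ u` as `v`;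
-- `⋆-comm` needs linearity in exactly this form.
⋆-linear : ∀ f c (u v : Sequence) n →
  (f ⋆ (λ m → c ℤ.* u m ℤ.+ v m)) n ≡ c ℤ.* (f ⋆ u) n ℤ.+ (f ⋆ v) n
⋆-linear []      c u v n = sym (trans (ℤₚ.+-identityʳ _) (ℤₚ.*-zeroʳ c))
⋆-linear (a ∷ f) c u v n rewrite ⋆-linear f c u v (suc n) = eq a c (u n) (v n) _ _
  where
  eq : ∀ a c x y s t →
    a ℤ.* (c ℤ.* x ℤ.+ y) ℤ.+ (c ℤ.* s ℤ.+ t) ≡ c ℤ.* (a ℤ.* x ℤ.+ s) ℤ.+ (a ℤ.* y ℤ.+ t)
  eq = solve-∀

⋆-zeroʳ : ∀ f n → (f ⋆ (λ _ → 0ℤ)) n ≡ 0ℤ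
⋆-zeroʳ []      n = refl
⋆-zeroʳ (a ∷ f) n rewrite ⋆-zeroʳ f (suc n) = trans (ℤₚ.+-identityʳ _) (ℤₚ.*-zeroʳ a)

⋆-shift : ∀ f u n → (f ⋆ (u ∘ suc)) n ≡ (f ⋆ u) (suc n)
⋆-shift []      u n = refl
⋆-shift (a ∷ f) u n = cong (ℤ._+_ (a ℤ.* u (suc n))) (⋆-shift f u (suc n))

0∷-⋆ : ∀ f u n → ((0ℤ ∷ f) ⋆ u) n ≡ (f ⋆ u) (suc n)
0∷-⋆ f u n = trans (cong (ℤ._+ (f ⋆ u) (suc n)) (ℤₚ.*-zeroˡ (u n))) (ℤₚ.+-identityˡ _)

*-⋆ : ∀ f g u n → ((f *ₚ g) ⋆ u) n ≡ (f ⋆ g ⋆ u) n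
*-⋆ []      g u n = refl
*-⋆ (a ∷ f) g u n = trans (+-⋆ (a ·ₚ g) _ u n)
  (cong₂ ℤ._+_ (·-⋆ a g u n) (trans (0∷-⋆ (f *ₚ g) u n) (*-⋆ f g u (suc n))))

⋆-comm : ∀ f g u n → (f ⋆ g ⋆ u) n ≡ (g ⋆ f ⋆ u) n
⋆-comm []      g u n = sym (⋆-zeroʳ g n)
⋆-comm (a ∷ f) g u n = trans
  (cong (ℤ._+_ (a ℤ.* (g ⋆ u) n)) (trans (⋆-comm f g u (suc n)) (sym (⋆-shift g (f ⋆ u) n))))
  (sym (⋆-linear g a u ((f ⋆ u) ∘ suc) n))

-- Kronecker delta. Acting on it and reading entry 0 recovers a coefficient, which is what makes the
-- action faithful.
δ : ℕ → Sequence
δ zero    zero    = 1ℤ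
δ zero    (suc _) = 0ℤ
δ (suc i) zero    = 0ℤ
δ (suc i) (suc j) = δ i j

⋆-δ : ∀ f i → (f ⋆ δ i) 0 ≡ coeff f i
⋆-δ []      i       = refl
⋆-δ (a ∷ f) zero    = trans
  (cong₂ ℤ._+_ (ℤₚ.*-identityʳ a) (trans (sym (⋆-shift f (δ 0) 0)) (⋆-zeroʳ f 0)))
  (ℤₚ.+-identityʳ a)
⋆-δ (a ∷ f) (suc i) = trans
  (cong₂ ℤ._+_ (ℤₚ.*-zeroʳ a) (trans (sym (⋆-shift f (δ (suc i)) 0)) (⋆-δ f i)))
  (ℤₚ.+-identityˡ _)

infix 4 _≋_

-- Unlike _≈_, which unfolds to a function type, this lets Agda infer f and g.
record _≋_ (f g : Poly) : Set where
  constructor mk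
  field at : f ≈ g

open _≋_ public

⋆-faithful : ∀ {f g} → (∀ u n → (f ⋆ u) n ≡ (g ⋆ u) n) → f ≋ g
⋆-faithful {f} {g} e = mk λ i → trans (sym (⋆-δ f i)) (trans (e (δ i) 0) (⋆-δ g i))

1-⋆ : ∀ u n → (1ₚ ⋆ u) n ≡ u n
1-⋆ u n = trans (ℤₚ.+-identityʳ _) (ℤₚ.*-identityˡ (u n))

*ₚ-comm : ∀ f g → f *ₚ g ≋ g *ₚ f
*ₚ-comm f g = ⋆-faithful λ u n →
  trans (*-⋆ f g u n) (trans (⋆-comm f g u n) (sym (*-⋆ g f u n)))

+ₚ-comm : ∀ f g → f +ₚ g ≋ g +ₚ f
+ₚ-comm f g = ⋆-faithful λ u n →
  trans (+-⋆ f g u n) (trans (ℤₚ.+-comm ((f ⋆ u) n) _) (sym (+-⋆ g f u n)))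

+ₚ-cong : ∀ {f f′ g g′} → f ≋ f′ → g ≋ g′ → f +ₚ g ≋ f′ +ₚ g′
+ₚ-cong {f} {f′} {g} {g′} d e = ⋆-faithful λ u n →
  trans (+-⋆ f g u n) (trans
    (cong₂ ℤ._+_ (⋆-congˡ f f′ (at d) u n) (⋆-congˡ g g′ (at e) u n))
    (sym (+-⋆ f′ g′ u n)))

≋-isEquivalence : IsEquivalence _≋_
≋-isEquivalence = record
  { refl  = mk λ _ → refl
  ; sym   = λ e → mk λ i → sym (at e i)
  ; trans = λ d e → mk λ i → trans (at d i) (at e i)
  }

≋-setoid : Setoid 0ℓ 0ℓ
≋-setoid = record { isEquivalence = ≋-isEquivalence }

private module ≋ = Consequences ≋-setoid

polyRing : CommutativeRing 0ℓ 0ℓ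
polyRing = record
  { Carrier = Poly
  ; _≈_     = _≋_
  ; _+_     = _+ₚ_
  ; _*_     = _*ₚ_
  ; -_      = -1ℤ ·ₚ_
  ; 0#      = []
  ; 1#      = 1ₚ
  ; isCommutativeRing = record
    { isRing = record
      { +-isAbelianGroup = record
        { isGroup = record
          { isMonoid = record
            { isSemigroup = record
              { isMagma = record
                { isEquivalence = ≋-isEquivalence
                ; ∙-cong = +ₚ-cong
                }
              ; assoc = λ f g h → ⋆-faithful λ u n → begin
                  ((f +ₚ g +ₚ h) ⋆ u) n                     ≡⟨ +-⋆ (f +ₚ g) h u n ⟩
                  ((f +ₚ g) ⋆ u) n ℤ.+ (h ⋆ u) n            ≡⟨ cong (ℤ._+ (h ⋆ u) n) (+-⋆ f g u n) ⟩
                  (f ⋆ u) n ℤ.+ (g ⋆ u) n ℤ.+ (h ⋆ u) n     ≡⟨ ℤₚ.+-assoc ((f ⋆ u) n) _ _ ⟩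
                  (f ⋆ u) n ℤ.+ ((g ⋆ u) n ℤ.+ (h ⋆ u) n)   ≡⟨ cong (ℤ._+_ ((f ⋆ u) n)) (+-⋆ g h u n) ⟨
                  (f ⋆ u) n ℤ.+ ((g +ₚ h) ⋆ u) n            ≡⟨ +-⋆ f (g +ₚ h) u n ⟨
                  ((f +ₚ (g +ₚ h)) ⋆ u) n                   ∎
              }
            ; identity = ≋.comm∧idˡ⇒id +ₚ-comm λ f → mk λ _ → refl
            }
          ; inverse = ≋.comm∧invʳ⇒inv +ₚ-comm λ f → ⋆-faithful λ u n →
              trans (+-⋆ f _ u n) (trans (cong (ℤ._+_ ((f ⋆ u) n)) (trans (·-⋆ -1ℤ f u n) (ℤₚ.-1*i≡-i _)))
                (ℤₚ.+-inverseʳ ((f ⋆ u) n)))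
          ; ⁻¹-cong = λ {f} {g} e → ⋆-faithful λ u n →
              trans (·-⋆ -1ℤ f u n) (trans (cong (-1ℤ ℤ.*_) (⋆-congˡ f g (at e) u n)) (sym (·-⋆ -1ℤ g u n)))
          }
        ; comm = +ₚ-comm
        }
      ; *-cong = λ {f} {f′} {g} {g′} d e → ⋆-faithful λ u n → begin
          ((f *ₚ g) ⋆ u) n   ≡⟨ *-⋆ f g u n ⟩
          (f ⋆ g ⋆ u) n      ≡⟨ ⋆-congˡ f f′ (at d) (g ⋆ u) n ⟩
          (f′ ⋆ g ⋆ u) n     ≡⟨ ⋆-congʳ f′ (⋆-congˡ g g′ (at e) u) n ⟩
          (f′ ⋆ g′ ⋆ u) n    ≡⟨ *-⋆ f′ g′ u n ⟨
          ((f′ *ₚ g′) ⋆ u) n ∎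
      ; *-assoc = λ f g h → ⋆-faithful λ u n → begin
          ((f *ₚ g *ₚ h) ⋆ u) n   ≡⟨ *-⋆ (f *ₚ g) h u n ⟩
          ((f *ₚ g) ⋆ h ⋆ u) n    ≡⟨ *-⋆ f g (h ⋆ u) n ⟩
          (f ⋆ g ⋆ h ⋆ u) n       ≡⟨ ⋆-congʳ f (*-⋆ g h u) n ⟨
          (f ⋆ (g *ₚ h) ⋆ u) n    ≡⟨ *-⋆ f (g *ₚ h) u n ⟨
          ((f *ₚ (g *ₚ h)) ⋆ u) n ∎
      ; *-identity = ≋.comm∧idˡ⇒id *ₚ-comm λ f → ⋆-faithful λ u n → trans (*-⋆ 1ₚ f u n) (1-⋆ (f ⋆ u) n)
      ; distrib = ≋.comm∧distrʳ⇒distr +ₚ-cong *ₚ-comm λ f g h → ⋆-faithful λ u n → begin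
          (((g +ₚ h) *ₚ f) ⋆ u) n                ≡⟨ *-⋆ (g +ₚ h) f u n ⟩
          ((g +ₚ h) ⋆ f ⋆ u) n                   ≡⟨ +-⋆ g h (f ⋆ u) n ⟩
          (g ⋆ f ⋆ u) n ℤ.+ (h ⋆ f ⋆ u) n        ≡⟨ cong₂ ℤ._+_ (*-⋆ g f u n) (*-⋆ h f u n) ⟨
          ((g *ₚ f) ⋆ u) n ℤ.+ ((h *ₚ f) ⋆ u) n  ≡⟨ +-⋆ (g *ₚ f) (h *ₚ f) u n ⟨
          ((g *ₚ f +ₚ h *ₚ f) ⋆ u) n             ∎
      }
    ; *-comm = *ₚ-comm
    }
  }
  where open ≡-Reasoning

module 𝔸 = CommutativeRing polyRing
import Algebra.Properties.AbelianGroup 𝔸.+-abelianGroup as 𝔸-group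
import Algebra.Properties.CommutativeSemiring.Binomial 𝔸.commutativeSemiring as Binomial
open import Algebra.Properties.CommutativeSemigroup.Divisibility 𝔸.*-commutativeSemigroup
  using (_,_; ∣ʳ-trans; x∣xy) renaming (_∣_ to infix 4 _∣ᴾ_; _∤_ to infix 4 _∤ᴾ_)
open import Algebra.Properties.Monoid.Mult 𝔸.+-monoid using () renaming (_×_ to infixr 8 _×ₚ_)
open import Algebra.Properties.Monoid.Sum 𝔸.+-monoid using (sum-init-last) renaming (sum to ∑ᵛ)
open import Algebra.Properties.Semiring.Binomial 𝔸.semiring using (binomialTerm; binomial)
open import Algebra.Properties.Semiring.Exp 𝔸.semiring using (^-assocʳ; ^-congˡ) renaming (_^_ to infixr 8 _^ₚ_)
open import Relation.Binary.Reasoning.Setoid 𝔸.setoid as ≋-Reasoning using ()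

zero? : ∀ f → Maybe ([] ≋ f)
zero? f with ≈0? f
... | yes z = just (mk λ i → sym (z i z≤n))
... | no  _ = nothing

open Solver (fromCommutativeRing polyRing zero?) using (solve; _⊜_; _⊕_; _⊗_; ⊝_; Κ)

infixl 6 _+ˡ_ _+ʳ_
infixl 7 _*ˡ_ _*ʳ_

_+ˡ_ : ∀ f {g h} → g ≋ h → f +ₚ g ≋ f +ₚ h
f +ˡ e = +ₚ-cong (𝔸.refl {f}) e

_+ʳ_ : ∀ {g h} → g ≋ h → ∀ f → g +ₚ f ≋ h +ₚ f
e +ʳ f = +ₚ-cong e (𝔸.refl {f})

_*ˡ_ : ∀ f {g h} → g ≋ h → f *ₚ g ≋ f *ₚ h
f *ˡ e = 𝔸.*-cong (𝔸.refl {f}) e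

_*ʳ_ : ∀ {g h} → g ≋ h → ∀ f → g *ₚ f ≋ h *ₚ f
e *ʳ f = 𝔸.*-cong e (𝔸.refl {f})

∣ₚ⇒∣ : ∀ {f g} → g ∣ₚ f → g ∣ᴾ f
∣ₚ⇒∣ (q , e) = q , mk λ i → sym (e i)

∣⇒∣ₚ : ∀ {f g} → g ∣ᴾ f → g ∣ₚ f
∣⇒∣ₚ (q , e) = q , λ i → sym (at e i)

∣-+ : ∀ {f g h} → h ∣ᴾ f → h ∣ᴾ g → h ∣ᴾ f +ₚ g
∣-+ {h = h} (q , d) (r , e) = q +ₚ r , 𝔸.trans (𝔸.distribʳ h q r) (𝔸.+-cong d e)

∣-*ˡ : ∀ {f h} g → h ∣ᴾ f → h ∣ᴾ g *ₚ f
∣-*ˡ g (q , e) = g *ₚ q , 𝔸.trans (𝔸.*-assoc g q _) (g *ˡ e)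

∣-resp : ∀ {f g h} → h ∣ᴾ f → f ≋ g → h ∣ᴾ g
∣-resp (q , d) e = q , 𝔸.trans d e

-- Evaluation at 1, powers of x and geometric sums

ev₁ : Poly → ℤ
ev₁ f = eval f 1ℤ

-- Constant sequences are fixed by the shift, so x acts on them as 1. Evaluation at 1 thereby
-- inherits its homomorphism laws from the action.
⋆-const : ∀ f c n → (f ⋆ λ _ → c) n ≡ ev₁ f ℤ.* c
⋆-const []      c n = sym (ℤₚ.*-zeroˡ c)
⋆-const (a ∷ f) c n rewrite ⋆-const f c (suc n) = eq a c (ev₁ f)
  where
  eq : ∀ a c e → a ℤ.* c ℤ.+ e ℤ.* c ≡ (a ℤ.+ 1ℤ ℤ.* e) ℤ.* c
  eq = solve-∀

ev₁-as-⋆ : ∀ f → ev₁ f ≡ (f ⋆ λ _ → 1ℤ) 0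
ev₁-as-⋆ f = sym (trans (⋆-const f 1ℤ 0) (ℤₚ.*-identityʳ _))

ev₁-cong : ∀ {f g} → f ≋ g → ev₁ f ≡ ev₁ g
ev₁-cong {f} {g} e = trans (ev₁-as-⋆ f) (trans (⋆-congˡ f g (at e) _ 0) (sym (ev₁-as-⋆ g)))

ev₁-+ : ∀ f g → ev₁ (f +ₚ g) ≡ ev₁ f ℤ.+ ev₁ g
ev₁-+ f g = trans (ev₁-as-⋆ (f +ₚ g)) (trans (+-⋆ f g _ 0) (sym (cong₂ ℤ._+_ (ev₁-as-⋆ f) (ev₁-as-⋆ g))))

ev₁-* : ∀ f g → ev₁ (f *ₚ g) ≡ ev₁ f ℤ.* ev₁ g
ev₁-* f g = begin
  ev₁ (f *ₚ g)                      ≡⟨ ev₁-as-⋆ (f *ₚ g) ⟩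
  ((f *ₚ g) ⋆ (λ _ → 1ℤ)) 0         ≡⟨ *-⋆ f g _ 0 ⟩
  (f ⋆ g ⋆ (λ _ → 1ℤ)) 0            ≡⟨ ⋆-congʳ f (λ n → trans (⋆-const g 1ℤ n) (ℤₚ.*-identityʳ _)) 0 ⟩
  (f ⋆ (λ _ → ev₁ g)) 0             ≡⟨ ⋆-const f (ev₁ g) 0 ⟩
  ev₁ f ℤ.* ev₁ g                   ∎
  where open ≡-Reasoning

ev₁-∣ : ∀ {f g} → g ∣ᴾ f → ev₁ g ℤ∣.∣ ev₁ f
ev₁-∣ {f} {g} (q , e) = ℤ∣.divides (ev₁ q) (trans (sym (ev₁-cong e)) (ev₁-* q g))

κ : ℤ → Poly
κ c = c ∷ []

ev₁-κ : ∀ c → ev₁ (κ c) ≡ c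
ev₁-κ c = ℤₚ.+-identityʳ c

·-as-κ : ∀ c f → c ·ₚ f ≋ κ c *ₚ f
·-as-κ c f = ⋆-faithful λ u n → trans (·-⋆ c f u n)
  (sym (trans (*-⋆ (κ c) f u n) (ℤₚ.+-identityʳ _)))

κ-* : ∀ c d → κ (c ℤ.* d) ≋ κ c *ₚ κ d
κ-* c d = ·-as-κ c (κ d)

x^-⋆ : ∀ m u n → (x^ m ⋆ u) n ≡ u (n ℕ.+ m)
x^-⋆ zero    u n = trans (1-⋆ u n) (cong u (sym (ℕₚ.+-identityʳ n)))
x^-⋆ (suc m) u n = trans (0∷-⋆ (x^ m) u n)
  (trans (x^-⋆ m u (suc n)) (cong u (sym (ℕₚ.+-suc n m))))

x^-+ : ∀ m n → x^ (m ℕ.+ n) ≋ x^ m *ₚ x^ n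
x^-+ m n = ⋆-faithful λ u i → begin
  (x^ (m ℕ.+ n) ⋆ u) i     ≡⟨ x^-⋆ (m ℕ.+ n) u i ⟩
  u (i ℕ.+ (m ℕ.+ n))      ≡⟨ cong u (ℕₚ.+-assoc i m n) ⟨
  u (i ℕ.+ m ℕ.+ n)        ≡⟨ x^-⋆ n u (i ℕ.+ m) ⟨
  (x^ n ⋆ u) (i ℕ.+ m)     ≡⟨ x^-⋆ m (x^ n ⋆ u) i ⟨
  (x^ m ⋆ x^ n ⋆ u) i      ≡⟨ *-⋆ (x^ m) (x^ n) u i ⟨
  ((x^ m *ₚ x^ n) ⋆ u) i   ∎
  where open ≡-Reasoning

ev₁-x^ : ∀ m → ev₁ (x^ m) ≡ 1ℤ
ev₁-x^ m = trans (ev₁-as-⋆ (x^ m)) (x^-⋆ m _ 0)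

x^_⊖1 : ℕ → Poly
x^ m ⊖1 = x^ m -ₚ 1ₚ

-- The quotient (x^(km) - 1)/(x^m - 1). With `k = p` and `m = p^j` it is the cyclotomic polynomial
-- of index p^(j+1); with `m = 1` it is the all-ones polynomial.
geom : ℕ → ℕ → Poly
geom zero    m = []
geom (suc k) m = geom k m +ₚ x^ (k ℕ.* m)

ev₁-geom : ∀ k m → ev₁ (geom k m) ≡ + k
ev₁-geom zero    m = refl
ev₁-geom (suc k) m = trans (ev₁-+ (geom k m) _)
  (trans (cong₂ ℤ._+_ (ev₁-geom k m) (ev₁-x^ (k ℕ.* m))) (ℤₚ.+-comm (+ k) 1ℤ))

geom-* : ∀ k m → geom k m *ₚ x^ m ⊖1 ≋ x^ (k ℕ.* m) ⊖1
geom-* zero    m = mk λ { zero → refl ; (suc i) → refl }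
geom-* (suc k) m = begin
  (geom k m +ₚ x^ (k ℕ.* m)) *ₚ x^ m ⊖1
    ≈⟨ solve 3 (λ g y z → ((g ⊕ y) ⊗ (z ⊕ ⊝ Κ 1ₚ)) ⊜ (g ⊗ (z ⊕ ⊝ Κ 1ₚ) ⊕ (z ⊗ y ⊕ ⊝ y))) 𝔸.refl (geom k m) (x^ (k ℕ.* m)) (x^ m) ⟩
  geom k m *ₚ x^ m ⊖1 +ₚ (x^ m *ₚ x^ (k ℕ.* m) -ₚ x^ (k ℕ.* m))
    ≈⟨ 𝔸.+-cong (geom-* k m) (𝔸.sym (x^-+ m (k ℕ.* m)) +ʳ (-1ℤ ·ₚ x^ (k ℕ.* m))) ⟩
  x^ (k ℕ.* m) ⊖1 +ₚ (x^ (m ℕ.+ k ℕ.* m) -ₚ x^ (k ℕ.* m))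
    ≈⟨ solve 2 (λ y z → (y ⊕ ⊝ Κ 1ₚ ⊕ (z ⊕ ⊝ y)) ⊜ (z ⊕ ⊝ Κ 1ₚ)) 𝔸.refl (x^ (k ℕ.* m)) (x^ (m ℕ.+ k ℕ.* m)) ⟩
  x^ (m ℕ.+ k ℕ.* m) ⊖1 ∎
  where open ≋-Reasoning

x^-1-∣ : ∀ k m → x^ m ⊖1 ∣ᴾ x^ (k ℕ.* m) ⊖1
x^-1-∣ k m = geom k m , geom-* k m

x-1 : Poly
x-1 = x^ 1 ⊖1

-- Factor theorem in Horner form: x f - f(1) = x (f - f(1)) + f(1) (x - 1), and the constant term
-- `a` cancels.
x-1-∣ : ∀ f → x-1 ∣ᴾ f -ₚ κ (ev₁ f)
x-1-∣ []      = [] , mk λ { zero → refl ; (suc _) → refl }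
x-1-∣ (a ∷ f) with q , e ← x-1-∣ f = x^ 1 *ₚ q +ₚ κ (ev₁ f) , (begin
  (x^ 1 *ₚ q +ₚ κ (ev₁ f)) *ₚ x-1
    ≈⟨ solve 3 (λ y q c → ((y ⊗ q ⊕ c) ⊗ (y ⊕ ⊝ Κ 1ₚ)) ⊜ (y ⊗ (q ⊗ (y ⊕ ⊝ Κ 1ₚ)) ⊕ c ⊗ (y ⊕ ⊝ Κ 1ₚ))) 𝔸.refl (x^ 1) q (κ (ev₁ f)) ⟩
  x^ 1 *ₚ (q *ₚ x-1) +ₚ κ (ev₁ f) *ₚ x-1
    ≈⟨ x^ 1 *ˡ e +ʳ κ (ev₁ f) *ₚ x-1 ⟩
  x^ 1 *ₚ (f -ₚ κ (ev₁ f)) +ₚ κ (ev₁ f) *ₚ x-1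
    ≈⟨ solve 3 (λ y f c → (y ⊗ (f ⊕ ⊝ c) ⊕ c ⊗ (y ⊕ ⊝ Κ 1ₚ)) ⊜ (y ⊗ f ⊕ ⊝ c)) 𝔸.refl (x^ 1) f (κ (ev₁ f)) ⟩
  x^ 1 *ₚ f -ₚ κ (ev₁ f)
    ≈⟨ ⋆-faithful (λ u n → shift u n) ⟩
  (a ∷ f) -ₚ κ (ev₁ (a ∷ f)) ∎)
  where
  open ≋-Reasoning
  -⋆ : ∀ f g u n → ((f -ₚ g) ⋆ u) n ≡ (f ⋆ u) n ℤ.+ -1ℤ ℤ.* (g ⋆ u) n
  -⋆ f g u n = trans (+-⋆ f _ u n) (cong (ℤ._+_ ((f ⋆ u) n)) (·-⋆ -1ℤ g u n))
  shift : ∀ u n → ((x^ 1 *ₚ f -ₚ κ (ev₁ f)) ⋆ u) n ≡ (((a ∷ f) -ₚ κ (ev₁ (a ∷ f))) ⋆ u) n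
  shift u n = trans (-⋆ (x^ 1 *ₚ f) (κ (ev₁ f)) u n) (trans
    (cong (ℤ._+ -1ℤ ℤ.* (κ (ev₁ f) ⋆ u) n)
      (trans (*-⋆ (x^ 1) f u n) (trans (x^-⋆ 1 (f ⋆ u) n) (cong (f ⋆ u) (ℕₚ.+-comm n 1)))))
    (trans (eq a (ev₁ f) (u n) ((f ⋆ u) (suc n))) (sym (-⋆ (a ∷ f) (κ (ev₁ (a ∷ f))) u n))))
    where
    eq : ∀ a e x s → s ℤ.+ -1ℤ ℤ.* (e ℤ.* x ℤ.+ 0ℤ)
       ≡ (a ℤ.* x ℤ.+ s) ℤ.+ -1ℤ ℤ.* ((a ℤ.+ 1ℤ ℤ.* e) ℤ.* x ℤ.+ 0ℤ)
    eq = solve-∀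

-- Primality of polynomials of Eisenstein type at 1

Monic : ℕ → Poly → Set
Monic N f = coeff f N ≡ 1ℤ × VanishesFrom (suc N) f

vanishing⇒≋[] : ∀ {f} → VanishesFrom 0 f → f ≋ []
vanishing⇒≋[] z = mk λ i → z i z≤n

-- The top coefficient of a nonzero `q` survives in `q *ₚ g`, in degree at least `N`. This gives
-- uniqueness of remainders.
monic-∣⇒≋[] : ∀ {N g r} → Monic N g → VanishesFrom N r → g ∣ᴾ r → r ≋ []
monic-∣⇒≋[] {N} {g} {r} (lead , van) rv (q , e) with degree q
... | inj₁ v            = vanishing⇒≋[] λ i p → trans (sym (at e i)) (0*ₚ q g v i p)
... | inj₂ (m , nz , v) = contradiction (begin
  coeff q m                     ≡⟨ ℤₚ.*-identityʳ _ ⟨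
  coeff q m ℤ.* 1ℤ              ≡⟨ cong (coeff q m ℤ.*_) lead ⟨
  coeff q m ℤ.* coeff g N       ≡⟨ top-coeff-* q g m N v van ⟨
  coeff (q *ₚ g) (m ℕ.+ N)      ≡⟨ at e (m ℕ.+ N) ⟩
  coeff r (m ℕ.+ N)             ≡⟨ rv _ (ℕₚ.m≤n+m N m) ⟩
  0ℤ                            ∎) nz
  where open ≡-Reasoning

∷-as-κ : ∀ a f → a ∷ f ≋ κ a +ₚ x^ 1 *ₚ f
∷-as-κ a f = ⋆-faithful λ u n → sym (trans (+-⋆ (κ a) (x^ 1 *ₚ f) u n) (cong₂ ℤ._+_
  (ℤₚ.+-identityʳ (a ℤ.* u n))
  (trans (*-⋆ (x^ 1) f u n) (trans (x^-⋆ 1 (f ⋆ u) n) (cong (f ⋆ u) (ℕₚ.+-comm n 1))))))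

-- If `r` is the remainder of `f`, then a + x r has degree at most `N`, and one multiple of `g`
-- clears its coefficient `t` in degree `N`.
remainder : ∀ {N g} → Monic N g → ∀ f → ∃[ q ] ∃[ r ] (f ≋ q *ₚ g +ₚ r × VanishesFrom N r)
remainder mon [] = [] , [] , 𝔸.refl , λ _ _ → refl
remainder {N} {g} (lead , van) (a ∷ f) with q , r , e , v ← remainder (lead , van) f =
  x^ 1 *ₚ q +ₚ κ t , (a ∷ r) -ₚ (t ·ₚ g) , (begin
    a ∷ f
      ≈⟨ ∷-as-κ a f ⟩
    κ a +ₚ x^ 1 *ₚ f
      ≈⟨ κ a +ˡ x^ 1 *ˡ e ⟩
    κ a +ₚ x^ 1 *ₚ (q *ₚ g +ₚ r)
      ≈⟨ solve 6 (λ a y q g r t → (a ⊕ y ⊗ (q ⊗ g ⊕ r)) ⊜ ((y ⊗ q ⊕ t) ⊗ g ⊕ (a ⊕ y ⊗ r ⊕ ⊝ (t ⊗ g)))) 𝔸.refl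
           (κ a) (x^ 1) q g r (κ t) ⟩
    (x^ 1 *ₚ q +ₚ κ t) *ₚ g +ₚ (κ a +ₚ x^ 1 *ₚ r -ₚ κ t *ₚ g)
      ≈⟨ (x^ 1 *ₚ q +ₚ κ t) *ₚ g +ˡ 𝔸.+-cong (𝔸.sym (∷-as-κ a r)) (𝔸.-‿cong (𝔸.sym (·-as-κ t g))) ⟩
    (x^ 1 *ₚ q +ₚ κ t) *ₚ g +ₚ ((a ∷ r) -ₚ (t ·ₚ g)) ∎) , van′
  where
  t = coeff (a ∷ r) N
  open ≋-Reasoning
  van″ : ∀ i → N < i → coeff (a ∷ r) i ≡ 0ℤ
  van″ (suc i) (s≤s p) = v i p
  van′ : VanishesFrom N ((a ∷ r) -ₚ (t ·ₚ g))
  van′ i p with ℕₚ.m≤n⇒m<n∨m≡n p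
  ... | inj₂ refl = trans (coeff-- (a ∷ r) (t ·ₚ g) N) (trans
    (cong (ℤ._-_ t) (trans (coeff-· t g N) (trans (cong (t ℤ.*_) lead) (ℤₚ.*-identityʳ t))))
    (ℤₚ.+-inverseʳ t))
  ... | inj₁ N<i = trans (coeff-- (a ∷ r) (t ·ₚ g) i) (cong₂ ℤ._-_ (van″ i N<i)
    (trans (coeff-· t g i) (trans (cong (t ℤ.*_) (van i N<i)) (ℤₚ.*-zeroʳ t))))

infix 4 _∈⟨_,_⟩

-- Membership in the ideal generated by `g` and `h`. With `h = φ` it is divisibility by `g` modulo
-- φ, so that no quotient ring has to be formed.
record _∈⟨_,_⟩ (f g h : Poly) : Set where
  constructor combination
  field
    {s t} : Poly
    proof : f ≋ s *ₚ g +ₚ t *ₚ h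

1∈⟨1,⟩ : ∀ f h → f ∈⟨ 1ₚ , h ⟩
1∈⟨1,⟩ f h = combination {s = f} {t = []} (𝔸.sym (𝔸.trans (𝔸.+-identityʳ (f *ₚ 1ₚ)) (𝔸.*-identityʳ f)))

∈-trans : ∀ {f g g′ h} → f ∈⟨ g , h ⟩ → g ∈⟨ g′ , h ⟩ → f ∈⟨ g′ , h ⟩
∈-trans {g′ = g′} {h} (combination {s} {t} d) (combination {s′} {t′} e) = combination {s = s *ₚ s′} {t = s *ₚ t′ +ₚ t} (𝔸.trans d (𝔸.trans
  (s *ˡ e +ʳ t *ₚ h)
  (solve 6 (λ s s′ g t′ h t → (s ⊗ (s′ ⊗ g ⊕ t′ ⊗ h) ⊕ t ⊗ h) ⊜ ((s ⊗ s′) ⊗ g ⊕ (s ⊗ t′ ⊕ t) ⊗ h)) 𝔸.refl s s′ g′ t′ h t)))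

∈-* : ∀ {f g f′ g′ h} → f ∈⟨ g , h ⟩ → f′ ∈⟨ g′ , h ⟩ → f *ₚ f′ ∈⟨ g *ₚ g′ , h ⟩
∈-* {g = g} {g′ = g′} {h} (combination {s} {t} d) (combination {s′} {t′} e) = combination
  {s = s *ₚ s′} {t = s *ₚ g *ₚ t′ +ₚ t *ₚ (s′ *ₚ g′ +ₚ t′ *ₚ h)} (𝔸.trans (𝔸.*-cong d e)
  (solve 7 (λ s g t h s′ g′ t′ → ((s ⊗ g ⊕ t ⊗ h) ⊗ (s′ ⊗ g′ ⊕ t′ ⊗ h))
     ⊜ ((s ⊗ s′) ⊗ (g ⊗ g′) ⊕ (s ⊗ g ⊗ t′ ⊕ t ⊗ (s′ ⊗ g′ ⊕ t′ ⊗ h)) ⊗ h)) 𝔸.refl s g t h s′ g′ t′))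

-- Modulo φ, `f` is `c s`, so `c` times the remainder of `s` is another remainder of `f`. By
-- uniqueness it equals `r`.
remainder-∈ : ∀ {N φ c f q r} → Monic N φ → f ∈⟨ κ c , φ ⟩ → f ≋ q *ₚ φ +ₚ r → VanishesFrom N r →
  ∀ i → c ℤ∣.∣ coeff r i
remainder-∈ {N} {φ} {c} {f} {q} {r} mon (combination {s} {t} d) e v i
  with q′ , r′ , e′ , v′ ← remainder mon s = ℤ∣.divides (coeff r′ i) (begin
    coeff r i                  ≡⟨ ℤₚ.i-j≡0⇒i≡j _ _ (trans (sym (coeff-- r (c ·ₚ r′) i)) (at difference i)) ⟩
    coeff (c ·ₚ r′) i          ≡⟨ coeff-· c r′ i ⟩
    c ℤ.* coeff r′ i           ≡⟨ ℤₚ.*-comm c _ ⟩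
    coeff r′ i ℤ.* c           ∎)
  where
  multiple : (q′ *ₚ κ c +ₚ t -ₚ q) *ₚ φ ≋ r -ₚ c ·ₚ r′
  multiple = begin
    (q′ *ₚ κ c +ₚ t -ₚ q) *ₚ φ
      ≈⟨ solve 6 (λ q′ c t q φ r′ → ((q′ ⊗ c ⊕ t ⊕ ⊝ q) ⊗ φ)
           ⊜ (((q′ ⊗ φ ⊕ r′) ⊗ c ⊕ t ⊗ φ) ⊕ ⊝ (q ⊗ φ) ⊕ ⊝ (c ⊗ r′))) 𝔸.refl q′ (κ c) t q φ r′ ⟩
    (q′ *ₚ φ +ₚ r′) *ₚ κ c +ₚ t *ₚ φ -ₚ q *ₚ φ -ₚ κ c *ₚ r′
      ≈⟨ ((𝔸.sym e′ *ʳ κ c +ʳ t *ₚ φ) +ʳ (-1ℤ ·ₚ (q *ₚ φ))) +ʳ (-1ℤ ·ₚ (κ c *ₚ r′)) ⟩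
    s *ₚ κ c +ₚ t *ₚ φ -ₚ q *ₚ φ -ₚ κ c *ₚ r′
      ≈⟨ (𝔸.trans (𝔸.sym d) e +ʳ (-1ℤ ·ₚ (q *ₚ φ))) +ʳ (-1ℤ ·ₚ (κ c *ₚ r′)) ⟩
    q *ₚ φ +ₚ r -ₚ q *ₚ φ -ₚ κ c *ₚ r′
      ≈⟨ solve 3 (λ y r z → (y ⊕ r ⊕ ⊝ y ⊕ ⊝ z) ⊜ (r ⊕ ⊝ z)) 𝔸.refl (q *ₚ φ) r (κ c *ₚ r′) ⟩
    r -ₚ κ c *ₚ r′
      ≈⟨ r +ˡ 𝔸.-‿cong (𝔸.sym (·-as-κ c r′)) ⟩
    r -ₚ c ·ₚ r′ ∎
    where open ≋-Reasoning
  open ≡-Reasoning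
  difference : r -ₚ c ·ₚ r′ ≋ []
  difference = monic-∣⇒≋[] mon
    (λ i p → trans (coeff-- r (c ·ₚ r′) i) (cong₂ ℤ._-_ (v i p)
      (trans (coeff-· c r′ i) (trans (cong (c ℤ.*_) (v′ i p)) (ℤₚ.*-zeroʳ c)))))
    (q′ *ₚ κ c +ₚ t -ₚ q , multiple)

-- A bound for all coefficients at once, used to conclude that a polynomial divisible by a large
-- enough power of p vanishes.
height : Poly → ℕ
height []      = 0
height (a ∷ f) = ℤ.∣ a ∣ ℕ.+ height f

coeff≤height : ∀ f i → ℤ.∣ coeff f i ∣ ≤ height f
coeff≤height []      i       = z≤n
coeff≤height (a ∷ f) zero    = ℕₚ.m≤m+n _ _
coeff≤height (a ∷ f) (suc i) = ℕₚ.≤-trans (coeff≤height f i) (ℕₚ.m≤n+m _ ℤ.∣ a ∣)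

∣∧<⇒≡0 : ∀ {m n} → n ℕ∣.∣ m → m < n → m ≡ 0
∣∧<⇒≡0 {zero}  _   _   = refl
∣∧<⇒≡0 {suc m} n∣m m<n = contradiction (ℕ∣.∣⇒≤ n∣m) (ℕₚ.<⇒≱ m<n)

multiples-below-height⇒≋[] : ∀ {r n} → height r < n → (∀ i → + n ℤ∣.∣ coeff r i) → r ≋ []
multiples-below-height⇒≋[] {r} {n} h<n d = mk λ i →
  ℤₚ.∣i∣≡0⇒i≡0 (∣∧<⇒≡0 (ℤ∣.∣⇒∣ᵤ (d i)) (ℕₚ.≤-<-trans (coeff≤height r i) h<n))

κ^ : ∀ c m → κ (+ c) ^ₚ m ≋ κ (+ (c ℕ.^ m))
κ^ c zero    = 𝔸.refl
κ^ c (suc m) = 𝔸.trans (κ (+ c) *ˡ κ^ c m)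
  (𝔸.trans (𝔸.sym (κ-* (+ c) (+ (c ℕ.^ m)))) (mk λ i → cong (λ z → coeff (κ z) i) (sym (ℤₚ.pos-* c _))))

x-1-monic : Monic 1 x-1
x-1-monic = refl , λ { (suc (suc i)) _ → refl ; (suc zero) (s≤s ()) }

monic-cancelʳ : ∀ {N h} → Monic N h → ∀ f g → f *ₚ h ≋ g *ₚ h → f ≋ g
monic-cancelʳ {N} {h} (lead , van) f g e = 𝔸-group.x∙y⁻¹≈ε⇒x≈y f g (zero-factor (degree (f -ₚ g)))
  where
  product-zero : (f -ₚ g) *ₚ h ≋ []
  product-zero = 𝔸.trans
    (solve 3 (λ f g y → ((f ⊕ ⊝ g) ⊗ y) ⊜ (f ⊗ y ⊕ ⊝ (g ⊗ y))) 𝔸.refl f g h)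
    (𝔸-group.x≈y⇒x∙y⁻¹≈ε e)
  zero-factor : VanishesFrom 0 (f -ₚ g) ⊎ ∃[ n ] (coeff (f -ₚ g) n ≢ 0ℤ × VanishesFrom (suc n) (f -ₚ g)) → f -ₚ g ≋ []
  zero-factor (inj₁ v)            = vanishing⇒≋[] v
  zero-factor (inj₂ (n , nz , v)) = contradiction (begin
    coeff (f -ₚ g) n                   ≡⟨ ℤₚ.*-identityʳ _ ⟨
    coeff (f -ₚ g) n ℤ.* 1ℤ            ≡⟨ cong (coeff (f -ₚ g) n ℤ.*_) lead ⟨
    coeff (f -ₚ g) n ℤ.* coeff h N     ≡⟨ top-coeff-* (f -ₚ g) h n N v van ⟨
    coeff ((f -ₚ g) *ₚ h) (n ℕ.+ N)    ≡⟨ at product-zero (n ℕ.+ N) ⟩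
    0ℤ                                 ∎) nz
    where open ≡-Reasoning

ev₁≡0⇒x-1-∣ : ∀ {f} → ev₁ f ≡ 0ℤ → x-1 ∣ᴾ f
ev₁≡0⇒x-1-∣ {f} z = ∣-resp (x-1-∣ f) (subst (λ c → f -ₚ κ c ≋ f) (sym z)
  (𝔸.trans (f +ˡ mk λ { zero → refl ; (suc _) → refl }) (𝔸.+-identityʳ f)))

-- A polynomial φ of Eisenstein type at x = 1: modulo φ, the element x - 1 generates
-- a prime above p, and some power of it is divisible by p.  Division of both factors
-- of a product in (φ) by x - 1 never stops unless one of them lies in (φ).
module Eisenstein {p N K : ℕ} {φ : Poly} (prime-p : Prime p) (monic : Monic N φ)
  (ev₁-φ : ev₁ φ ≡ + p) (ramified : x-1 ^ₚ K ∈⟨ κ (+ p) , φ ⟩) where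

  -- Evaluating g (x - 1) = h φ at 1 gives h(1) p = 0. Hence x - 1 divides `h` and cancels on both
  -- sides.
  x-1-regular : ∀ g → φ ∣ᴾ g *ₚ x-1 → φ ∣ᴾ g
  x-1-regular g (h , e) = from (ev₁≡0⇒x-1-∣ h-root)
    where
    h-root : ev₁ h ≡ 0ℤ
    h-root with ℤₚ.i*j≡0⇒i≡0∨j≡0 (ev₁ h) {ev₁ φ}
      (trans (sym (ev₁-* h φ)) (trans (ev₁-cong e) (trans (ev₁-* g x-1) (ℤₚ.*-zeroʳ (ev₁ g)))))
    ... | inj₁ z = z
    ... | inj₂ z = contradiction (ℤₚ.+-injective (trans (sym ev₁-φ) z)) (ℕ.≢-nonZero⁻¹ p {{prime⇒nonZero prime-p}})
    open ≋-Reasoning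
    from : x-1 ∣ᴾ h → φ ∣ᴾ g
    from (q , d) = q , monic-cancelʳ x-1-monic (q *ₚ φ) g (begin
      q *ₚ φ *ₚ x-1   ≈⟨ solve 3 (λ q f y → (q ⊗ f ⊗ y) ⊜ (q ⊗ y ⊗ f)) 𝔸.refl q φ x-1 ⟩
      q *ₚ x-1 *ₚ φ   ≈⟨ d *ʳ φ ⟩
      h *ₚ φ          ≈⟨ e ⟩
      g *ₚ x-1        ∎)

  -- As φ(1) = p, a value a(1) = k p is cancelled by subtracting k φ, and the difference has the
  -- root 1.
  p∣ev₁⇒∈⟨x-1⟩ : ∀ {a} → + p ℤ∣.∣ ev₁ a → a ∈⟨ x-1 , φ ⟩
  p∣ev₁⇒∈⟨x-1⟩ {a} (ℤ∣.divides k d) = from (ev₁≡0⇒x-1-∣ root)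
    where
    root : ev₁ (a -ₚ κ k *ₚ φ) ≡ 0ℤ
    root = trans (ev₁-+ a _) (trans (cong (ℤ._+_ (ev₁ a))
        (trans (ev₁-cong (·-as-κ -1ℤ (κ k *ₚ φ))) (trans (ev₁-* (κ -1ℤ) (κ k *ₚ φ))
          (cong (-1ℤ ℤ.*_) (trans (ev₁-* (κ k) φ) (cong₂ ℤ._*_ (ev₁-κ k) ev₁-φ))))))
      (trans (cong (ℤ._+ -1ℤ ℤ.* (k ℤ.* + p)) d) (trans (cong (ℤ._+_ (k ℤ.* + p)) (ℤₚ.-1*i≡-i _)) (ℤₚ.+-inverseʳ (k ℤ.* + p)))))
    open ≋-Reasoning
    from : x-1 ∣ᴾ a -ₚ κ k *ₚ φ → a ∈⟨ x-1 , φ ⟩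
    from (q , e) = combination {s = q} {t = κ k} (begin
      a                              ≈⟨ solve 2 (λ a y → a ⊜ (a ⊕ ⊝ y ⊕ y)) 𝔸.refl a (κ k *ₚ φ) ⟩
      a -ₚ κ k *ₚ φ +ₚ κ k *ₚ φ      ≈⟨ 𝔸.sym e +ʳ κ k *ₚ φ ⟩
      q *ₚ x-1 +ₚ κ k *ₚ φ           ∎)

  p∣ev₁-factor : ∀ {a b} → φ ∣ᴾ a *ₚ b → (+ p ℤ∣.∣ ev₁ a) ⊎ (+ p ℤ∣.∣ ev₁ b)
  p∣ev₁-factor {a} {b} φ∣ab = Sum.map ℤ∣.∣ᵤ⇒∣ ℤ∣.∣ᵤ⇒∣ (euclidsLemma ℤ.∣ ev₁ a ∣ ℤ.∣ ev₁ b ∣ prime-p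
    (subst (p ℕ∣.∣_) (ℤₚ.abs-* (ev₁ a) (ev₁ b))
      (ℤ∣.∣⇒∣ᵤ (subst₂ ℤ∣._∣_ ev₁-φ (ev₁-* a b) (ev₁-∣ φ∣ab)))))

  -- If a = s (x - 1) + t φ, then s b (x - 1) = a b - t φ b is a multiple of φ, and `x-1-regular`
  -- removes x - 1. The last component carries what is found for `s` back to `a`, with the exponent
  -- raised by one.
  divide : ∀ {a i} b → φ ∣ᴾ a *ₚ b → a ∈⟨ x-1 , φ ⟩ →
    ∃[ a′ ] (φ ∣ᴾ a′ *ₚ b × (a′ ∈⟨ x-1 ^ₚ i , φ ⟩ → a ∈⟨ x-1 ^ₚ suc i , φ ⟩))
  divide {a} {i} b (h , e) (combination {s} {t} d) = s , x-1-regular (s *ₚ b) (h -ₚ t *ₚ b , (begin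
      (h -ₚ t *ₚ b) *ₚ φ
        ≈⟨ solve 4 (λ h t b f → ((h ⊕ ⊝ (t ⊗ b)) ⊗ f) ⊜ (h ⊗ f ⊕ ⊝ (t ⊗ f ⊗ b))) 𝔸.refl h t b φ ⟩
      h *ₚ φ -ₚ t *ₚ φ *ₚ b
        ≈⟨ 𝔸.trans e (d *ʳ b) +ʳ (-1ℤ ·ₚ (t *ₚ φ *ₚ b)) ⟩
      (s *ₚ x-1 +ₚ t *ₚ φ) *ₚ b -ₚ t *ₚ φ *ₚ b
        ≈⟨ solve 4 (λ s y z b → ((s ⊗ y ⊕ z) ⊗ b ⊕ ⊝ (z ⊗ b)) ⊜ (s ⊗ b ⊗ y)) 𝔸.refl s x-1 (t *ₚ φ) b ⟩
      s *ₚ b *ₚ x-1 ∎)) , raise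
    where
    open ≋-Reasoning
    raise : s ∈⟨ x-1 ^ₚ i , φ ⟩ → a ∈⟨ x-1 ^ₚ suc i , φ ⟩
    raise (combination {s′} {t′} d′) = combination {s = s′} {t = t′ *ₚ x-1 +ₚ t} (begin
      a
        ≈⟨ d ⟩
      s *ₚ x-1 +ₚ t *ₚ φ
        ≈⟨ d′ *ʳ x-1 +ʳ t *ₚ φ ⟩
      (s′ *ₚ x-1 ^ₚ i +ₚ t′ *ₚ φ) *ₚ x-1 +ₚ t *ₚ φ
        ≈⟨ solve 6 (λ s′ z t′ f y t → ((s′ ⊗ z ⊕ t′ ⊗ f) ⊗ y ⊕ t ⊗ f) ⊜ (s′ ⊗ (y ⊗ z) ⊕ (t′ ⊗ y ⊕ t) ⊗ f))
             𝔸.refl s′ (x-1 ^ₚ i) t′ φ x-1 t ⟩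
      s′ *ₚ x-1 ^ₚ suc i +ₚ (t′ *ₚ x-1 +ₚ t) *ₚ φ ∎)

  -- Two counters run down: Euclid's lemma at x = 1 names a factor from which x - 1 can be taken,
  -- and the counter of that factor decreases. The factor whose counter reaches 0 has been divided
  -- as often as required.
  split : ∀ i k a b → φ ∣ᴾ a *ₚ b → (a ∈⟨ x-1 ^ₚ i , φ ⟩) ⊎ (b ∈⟨ x-1 ^ₚ k , φ ⟩)
  split zero    k       a b d = inj₁ (1∈⟨1,⟩ a φ)
  split (suc i) zero    a b d = inj₂ (1∈⟨1,⟩ b φ)
  split (suc i) (suc k) a b d = Sum.[ left , right ]′ (p∣ev₁-factor {a} {b} d)
    where
    left : + p ℤ∣.∣ ev₁ a → (a ∈⟨ x-1 ^ₚ suc i , φ ⟩) ⊎ (b ∈⟨ x-1 ^ₚ suc k , φ ⟩)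
    left p∣a = Sum.map₁ (proj₂ (proj₂ divided)) (split i (suc k) (proj₁ divided) b (proj₁ (proj₂ divided)))
      where divided = divide {a} {i} b d (p∣ev₁⇒∈⟨x-1⟩ p∣a)
    right : + p ℤ∣.∣ ev₁ b → (a ∈⟨ x-1 ^ₚ suc i , φ ⟩) ⊎ (b ∈⟨ x-1 ^ₚ suc k , φ ⟩)
    right p∣b = Sum.map₂ (proj₂ (proj₂ divided))
        (split (suc i) k a (proj₁ divided) (∣-resp (proj₁ (proj₂ divided)) (*ₚ-comm (proj₁ divided) a)))
      where divided = divide {b} {k} a (∣-resp d (*ₚ-comm a b)) (p∣ev₁⇒∈⟨x-1⟩ p∣b)

  ramified-^ : ∀ m → x-1 ^ₚ (K ℕ.* m) ∈⟨ κ (+ (p ℕ.^ m)) , φ ⟩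
  ramified-^ m = ∈-resp (𝔸.sym (^-assocʳ x-1 K m)) (κ^ p m) (power m)
    where
    power : ∀ m → (x-1 ^ₚ K) ^ₚ m ∈⟨ κ (+ p) ^ₚ m , φ ⟩
    power zero    = 1∈⟨1,⟩ 1ₚ φ
    power (suc m) = ∈-* ramified (power m)
    ∈-resp : ∀ {f f′ g g′} → f′ ≋ f → g ≋ g′ → f ∈⟨ g , φ ⟩ → f′ ∈⟨ g′ , φ ⟩
    ∈-resp e d (combination {s} {t} c) = combination {s = s} {t = t} (𝔸.trans e (𝔸.trans c (s *ˡ d +ʳ t *ₚ φ)))

  prime : ∀ a b → φ ∣ᴾ a *ₚ b → φ ∣ᴾ a ⊎ φ ∣ᴾ b
  prime a b d with qa , ra , ea , va ← remainder monic a | qb , rb , eb , vb ← remainder monic b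
    = Sum.map (conclude a qa ra ea va (ℕₚ.m≤m+n _ _)) (conclude b qb rb eb vb (ℕₚ.m≤n+m _ _))
        (split (K ℕ.* m) (K ℕ.* m) a b d)
    where
    -- Since m < p^m, the power p^m exceeds the height of either remainder, so a remainder with all
    -- coefficients divisible by p^m is zero. One exponent serves whichever factor `split` selects.
    m = height ra ℕ.+ height rb
    conclude : ∀ f q r → f ≋ q *ₚ φ +ₚ r → VanishesFrom N r → height r ≤ m →
      f ∈⟨ x-1 ^ₚ (K ℕ.* m) , φ ⟩ → φ ∣ᴾ f
    conclude f q r e v h mem = q , (begin
      q *ₚ φ         ≈⟨ 𝔸.+-identityʳ (q *ₚ φ) ⟨
      q *ₚ φ +ₚ []   ≈⟨ q *ₚ φ +ˡ r≋[] ⟨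
      q *ₚ φ +ₚ r    ≈⟨ e ⟨
      f              ∎)
      where
      open ≋-Reasoning
      r≋[] : r ≋ []
      r≋[] = multiples-below-height⇒≋[]
        (ℕₚ.≤-<-trans h (m<n^m p m (ℕ.nonTrivial⇒n>1 p {{prime⇒nonTrivial prime-p}})))
        (remainder-∈ {q = q} {r = r} monic (∈-trans mem (ramified-^ m)) e v)

-- Binomial coefficients and the Frobenius congruence modulo p

prime∤! : ∀ {p} → Prime p → ∀ k → k < p → ¬ (p ℕ∣.∣ k !)
prime∤! pp zero    k<p p∣1 = contradiction (ℕ∣.∣⇒≤ p∣1) (ℕₚ.<⇒≱ (ℕ.nonTrivial⇒n>1 _ {{prime⇒nonTrivial pp}}))
prime∤! pp (suc k) k<p p∣ with euclidsLemma (suc k) (k !) pp p∣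
... | inj₁ p∣k = contradiction (ℕ∣.∣⇒≤ p∣k) (ℕₚ.<⇒≱ k<p)
... | inj₂ p∣! = prime∤! pp k (ℕₚ.<-trans (ℕₚ.n<1+n k) k<p) p∣!

-- In p! = C(p,k) k! (p-k)! the prime divides the left side but neither of the two smaller
-- factorials.
prime∣C : ∀ {p} → Prime p → ∀ {k} → 0 < k → k < p → p ℕ∣.∣ p choose k
prime∣C {p@(suc p′)} pp {k} 0<k k<p =
  Sum.[ (λ p∣C → p∣C) , (λ p∣ → contradiction p∣ p∤k![p∸k]!) ]′ (euclidsLemma (p choose k) (k ! ℕ.* (p ℕ.∸ k) !) pp p∣product)
  where
  instance
    !*!≢0 : NonZero (k ! ℕ.* (p ℕ.∸ k) !)
    !*!≢0 = ℕₚ.m*n≢0 (k !) ((p ℕ.∸ k) !) {{k ℕₚ.!≢0}} {{(p ℕ.∸ k) ℕₚ.!≢0}}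
  product≡ : p choose k ℕ.* (k ! ℕ.* (p ℕ.∸ k) !) ≡ p !
  product≡ = trans (cong (ℕ._* (k ! ℕ.* (p ℕ.∸ k) !)) (nCk≡n!/k![n-k]! (ℕₚ.<⇒≤ k<p)))
    (m/n*n≡m (k![n∸k]!∣n! (ℕₚ.<⇒≤ k<p)))
  p∣product : p ℕ∣.∣ p choose k ℕ.* (k ! ℕ.* (p ℕ.∸ k) !)
  p∣product = subst (p ℕ∣.∣_) (sym product≡) (ℕ∣.m∣m*n (p′ !))
  p∤k![p∸k]! : ¬ (p ℕ∣.∣ k ! ℕ.* (p ℕ.∸ k) !)
  p∤k![p∸k]! p∣ = Sum.[ prime∤! pp k k<p , prime∤! pp (p ℕ.∸ k) (ℕₚ.∸-monoʳ-< 0<k (ℕₚ.<⇒≤ k<p)) ]′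
    (euclidsLemma (k !) ((p ℕ.∸ k) !) pp p∣)

κ-0 : κ 0ℤ ≋ []
κ-0 = mk λ { zero → refl ; (suc _) → refl }

×-as-κ : ∀ n f → n ×ₚ f ≋ κ (+ n) *ₚ f
×-as-κ zero    f = 𝔸.sym (κ-0 *ʳ f)
×-as-κ (suc n) f = 𝔸.trans (f +ˡ ×-as-κ n f)
  (solve 2 (λ f k → (f ⊕ k ⊗ f) ⊜ ((Κ 1ₚ ⊕ k) ⊗ f)) 𝔸.refl f (κ (+ n)))

∣-sum : ∀ {h n} (t : Vector Poly n) → (∀ i → h ∣ᴾ t i) → h ∣ᴾ ∑ᵛ t
∣-sum {h} {zero}  t d = [] , 𝔸.zeroˡ h
∣-sum {h} {suc n} t d = ∣-+ (d Fin.zero) (∣-sum (t ∘ Fin.suc) (d ∘ Fin.suc))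

infix 4 _≡_[mod_]

record _≡_[mod_] (f g h : Poly) : Set where
  constructor congruent
  field
    {t} : Poly
    proof : f ≋ g +ₚ t *ₚ h

freshman : ∀ {p} → Prime p → ∀ f g → (f +ₚ g) ^ₚ p ≡ f ^ₚ p +ₚ g ^ₚ p [mod κ (+ p) ]
freshman {p@(suc p′)} pp f g = from middle-∣
  where
  term : Vector Poly (suc p)
  term = binomialTerm f g p
  -- The terms with 0 < k < p, whose binomial coefficients are divisible by p; the two terms cut off
  -- at the ends are g^p and f^p.
  middle : Vector Poly p′
  middle = Vector.init (Vector.tail term)
  middle-∣ : κ (+ p) ∣ᴾ ∑ᵛ middle
  middle-∣ = ∣-sum middle λ i → divides-term (Fin.suc (inject₁ i)) (s≤s z≤n)
    (s≤s (subst (_< p′) (sym (Finₚ.toℕ-inject₁ i)) (Finₚ.toℕ<n i)))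
    where
    divides-term : ∀ (k : Fin (suc p)) → 0 < toℕ k → toℕ k < p → κ (+ p) ∣ᴾ term k
    divides-term k 0<k k<p with ℕ∣.divides c e ← prime∣C pp 0<k k<p = κ (+ c) *ₚ binomial f g p k , (begin
      κ (+ c) *ₚ binomial f g p k *ₚ κ (+ p)
        ≈⟨ solve 3 (λ c b p → (c ⊗ b ⊗ p) ⊜ (c ⊗ p ⊗ b)) 𝔸.refl (κ (+ c)) (binomial f g p k) (κ (+ p)) ⟩
      κ (+ c) *ₚ κ (+ p) *ₚ binomial f g p k
        ≈⟨ κ-* (+ c) (+ p) *ʳ binomial f g p k ⟨
      κ (+ c ℤ.* + p) *ₚ binomial f g p k
        ≡⟨ cong (λ z → κ z *ₚ binomial f g p k) (trans (sym (ℤₚ.pos-* c p)) (cong +_ (sym e))) ⟩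
      κ (+ (p choose toℕ k)) *ₚ binomial f g p k
        ≈⟨ ×-as-κ (p choose toℕ k) (binomial f g p k) ⟨
      term k ∎)
      where open ≋-Reasoning
  one-× : ∀ {n} h → n ≡ 1 → n ×ₚ h ≋ h
  one-× h refl = 𝔸.+-identityʳ h
  first : term Fin.zero ≋ g ^ₚ p
  first = 𝔸.trans (one-× (binomial f g p Fin.zero) refl) (𝔸.*-identityˡ (g ^ₚ p))
  final : Vector.last (Vector.tail term) ≋ f ^ₚ p
  final = 𝔸.trans (𝔸.reflexive (cong₂ (λ a b → (p choose a) ×ₚ (f ^ₚ a *ₚ g ^ₚ b)) to-p (trans (cong (p ℕ.∸_) to-p) (ℕₚ.n∸n≡0 p))))
    (𝔸.trans (one-× (f ^ₚ p *ₚ 1ₚ) (nCn≡1 p)) (𝔸.*-identityʳ (f ^ₚ p)))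
    where
    to-p : toℕ (Fin.suc (fromℕ p′)) ≡ p
    to-p = cong suc (Finₚ.toℕ-fromℕ p′)
  open ≋-Reasoning
  from : κ (+ p) ∣ᴾ ∑ᵛ middle → (f +ₚ g) ^ₚ p ≡ f ^ₚ p +ₚ g ^ₚ p [mod κ (+ p) ]
  from (q , e) = congruent {t = q} (begin
    (f +ₚ g) ^ₚ p
      ≈⟨ Binomial.theorem p f g ⟩
    term Fin.zero +ₚ ∑ᵛ (Vector.tail term)
      ≈⟨ term Fin.zero +ˡ sum-init-last (Vector.tail term) ⟩
    term Fin.zero +ₚ (∑ᵛ middle +ₚ Vector.last (Vector.tail term))
      ≈⟨ 𝔸.+-cong first (𝔸.+-cong (𝔸.sym e) final) ⟩
    g ^ₚ p +ₚ (q *ₚ κ (+ p) +ₚ f ^ₚ p)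
      ≈⟨ solve 3 (λ a b c → (b ⊕ (c ⊕ a)) ⊜ (a ⊕ b ⊕ c)) 𝔸.refl (f ^ₚ p) (g ^ₚ p) (q *ₚ κ (+ p)) ⟩
    f ^ₚ p +ₚ g ^ₚ p +ₚ q *ₚ κ (+ p) ∎)

1^ : ∀ n → 1ₚ ^ₚ n ≋ 1ₚ
1^ zero    = 𝔸.refl
1^ (suc n) = 𝔸.trans (𝔸.*-identityˡ (1ₚ ^ₚ n)) (1^ n)

freshman-^ : ∀ {p} → Prime p → ∀ f j → (f +ₚ 1ₚ) ^ₚ (p ℕ.^ j) ≡ f ^ₚ (p ℕ.^ j) +ₚ 1ₚ [mod κ (+ p) ]
freshman-^ {p} pp f zero = congruent {t = []}
  (solve 1 (λ f → ((f ⊕ Κ 1ₚ) ⊗ Κ 1ₚ) ⊜ (f ⊗ Κ 1ₚ ⊕ Κ 1ₚ ⊕ Κ [])) 𝔸.refl f)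
freshman-^ {p@(suc p′)} pp f (suc j) = from (freshman-^ pp f j)
  where
  open ≋-Reasoning
  w : Poly
  w = f ^ₚ (p ℕ.^ j)
  from : (f +ₚ 1ₚ) ^ₚ (p ℕ.^ j) ≡ w +ₚ 1ₚ [mod κ (+ p) ] →
         (f +ₚ 1ₚ) ^ₚ (p ℕ.* p ℕ.^ j) ≡ f ^ₚ (p ℕ.* p ℕ.^ j) +ₚ 1ₚ [mod κ (+ p) ]
  -- The error r p of the previous level is treated as a summand of its own. Its p-th power is again
  -- a multiple of p, which puts r (r p)^(p-1) into the new witness.
  from (congruent {r} ih) = from₂ (freshman pp (w +ₚ 1ₚ) (r *ₚ κ (+ p))) (freshman pp w 1ₚ)
    where
    from₂ : (w +ₚ 1ₚ +ₚ r *ₚ κ (+ p)) ^ₚ p ≡ (w +ₚ 1ₚ) ^ₚ p +ₚ (r *ₚ κ (+ p)) ^ₚ p [mod κ (+ p) ] →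
            (w +ₚ 1ₚ) ^ₚ p ≡ w ^ₚ p +ₚ 1ₚ ^ₚ p [mod κ (+ p) ] →
            (f +ₚ 1ₚ) ^ₚ (p ℕ.* p ℕ.^ j) ≡ f ^ₚ (p ℕ.* p ℕ.^ j) +ₚ 1ₚ [mod κ (+ p) ]
    from₂ (congruent {s} d) (congruent {t} e) =
      congruent {t = t +ₚ r *ₚ (r *ₚ κ (+ p)) ^ₚ p′ +ₚ s} (begin
        (f +ₚ 1ₚ) ^ₚ (p ℕ.* p ℕ.^ j)
          ≡⟨ cong ((f +ₚ 1ₚ) ^ₚ_) (ℕₚ.*-comm p (p ℕ.^ j)) ⟩
        (f +ₚ 1ₚ) ^ₚ (p ℕ.^ j ℕ.* p)
          ≈⟨ ^-assocʳ (f +ₚ 1ₚ) (p ℕ.^ j) p ⟨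
        ((f +ₚ 1ₚ) ^ₚ (p ℕ.^ j)) ^ₚ p
          ≈⟨ ^-congˡ p ih ⟩
        (w +ₚ 1ₚ +ₚ r *ₚ κ (+ p)) ^ₚ p
          ≈⟨ d ⟩
        (w +ₚ 1ₚ) ^ₚ p +ₚ (r *ₚ κ (+ p)) ^ₚ p +ₚ s *ₚ κ (+ p)
          ≈⟨ e +ʳ (r *ₚ κ (+ p)) ^ₚ p +ʳ s *ₚ κ (+ p) ⟩
        w ^ₚ p +ₚ 1ₚ ^ₚ p +ₚ t *ₚ κ (+ p) +ₚ (r *ₚ κ (+ p)) *ₚ (r *ₚ κ (+ p)) ^ₚ p′ +ₚ s *ₚ κ (+ p)
          ≈⟨ solve 7 (λ w o t k r z s → (w ⊕ o ⊕ t ⊗ k ⊕ (r ⊗ k) ⊗ z ⊕ s ⊗ k) ⊜ (w ⊕ o ⊕ (t ⊕ r ⊗ z ⊕ s) ⊗ k)) 𝔸.refl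
               (w ^ₚ p) (1ₚ ^ₚ p) t (κ (+ p)) r ((r *ₚ κ (+ p)) ^ₚ p′) s ⟩
        w ^ₚ p +ₚ 1ₚ ^ₚ p +ₚ rest
          ≈⟨ 𝔸.+-cong (^-assocʳ f (p ℕ.^ j) p) (1^ p) +ʳ rest ⟩
        f ^ₚ (p ℕ.^ j ℕ.* p) +ₚ 1ₚ +ₚ rest
          ≡⟨ cong (λ n → f ^ₚ n +ₚ 1ₚ +ₚ rest) (ℕₚ.*-comm (p ℕ.^ j) p) ⟩
        f ^ₚ (p ℕ.* p ℕ.^ j) +ₚ 1ₚ +ₚ rest ∎)
      where
      rest : Poly
      rest = (t +ₚ r *ₚ (r *ₚ κ (+ p)) ^ₚ p′ +ₚ s) *ₚ κ (+ p)

-- Cyclotomic polynomials of prime power index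

x^-monic : ∀ n → Monic n (x^ n)
x^-monic zero    = refl , λ { (suc i) _ → refl }
x^-monic (suc n) with lead , van ← x^-monic n = lead , λ { (suc i) (s≤s p) → van i p }

monic-+ : ∀ {n} f g → Monic n f → VanishesFrom n g → Monic n (f +ₚ g)
monic-+ {n} f g (lead , van) v =
  trans (coeff-+ f g n) (trans (cong₂ ℤ._+_ lead (v n ℕₚ.≤-refl)) (ℤₚ.+-identityʳ 1ℤ)) ,
  λ i p → trans (coeff-+ f g i) (cong₂ ℤ._+_ (van i p) (v i (ℕₚ.<⇒≤ p)))

monic-resp : ∀ {n f g} → f ≋ g → Monic n f → Monic n g
monic-resp e (lead , van) = trans (sym (at e _)) lead , λ i p → trans (sym (at e i)) (van i p)

geom-vanishing : ∀ k m .{{_ : NonZero m}} → VanishesFrom (k ℕ.* m) (geom k m)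
geom-vanishing zero    m i p = refl
geom-vanishing (suc k) m i p = trans (coeff-+ (geom k m) _ i)
  (cong₂ ℤ._+_ (geom-vanishing k m i (ℕₚ.<⇒≤ km<i)) (proj₂ (x^-monic (k ℕ.* m)) i km<i))
  where
  km<i : k ℕ.* m < i
  km<i = ℕₚ.<-≤-trans (ℕₚ.m<n+m (k ℕ.* m) (ℕ.>-nonZero⁻¹ m)) p

geom-monic : ∀ k m .{{_ : NonZero m}} → Monic (k ℕ.* m) (geom (suc k) m)
geom-monic k m = monic-resp (+ₚ-comm (x^ (k ℕ.* m)) (geom k m))
  (monic-+ (x^ (k ℕ.* m)) (geom k m) (x^-monic (k ℕ.* m)) (geom-vanishing k m))

x^⊖1-monic : ∀ m .{{_ : NonZero m}} → Monic m (x^ m ⊖1)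
x^⊖1-monic (suc m) = monic-+ (x^ suc m) (-1ℤ ·ₚ 1ₚ) (x^-monic (suc m)) λ { (suc i) _ → refl }

∏ₚ-↭ : ∀ {xs ys} → xs ↭ ys → ∏ₚ xs ≋ ∏ₚ ys
∏ₚ-↭ ↭.refl          = 𝔸.refl
∏ₚ-↭ (↭.prep f p)    = f *ˡ ∏ₚ-↭ p
∏ₚ-↭ (↭.swap {xs} f g p) = 𝔸.trans (solve 3 (λ f g z → (f ⊗ (g ⊗ z)) ⊜ (g ⊗ (f ⊗ z))) 𝔸.refl f g (∏ₚ xs)) (g *ˡ (f *ˡ ∏ₚ-↭ p))
∏ₚ-↭ (↭.trans p q)   = 𝔸.trans (∏ₚ-↭ p) (∏ₚ-↭ q)

∏ₚ-cong : ∀ {A : Set} {f g : A → Poly} {xs} → All (λ x → f x ≋ g x) xs → ∏ₚ (map f xs) ≋ ∏ₚ (map g xs)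
∏ₚ-cong []       = 𝔸.refl
∏ₚ-cong (e ∷ es) = 𝔸.*-cong e (∏ₚ-cong es)

prime∤⇒coprime : ∀ {p n} → Prime p → ¬ (p ℕ∣.∣ n) → Coprime n p
prime∤⇒coprime {p} {n} pp p∤n (d∣n , d∣p) with prime⇒irreducible pp d∣p
... | inj₁ d≡1 = d≡1
... | inj₂ d≡p = contradiction (subst (ℕ∣._∣ n) d≡p d∣n) p∤n

∣p^⇒power : ∀ {p} → Prime p → ∀ j {n} → n ℕ∣.∣ p ℕ.^ j → ∃[ i ] (i ≤ j × n ≡ p ℕ.^ i)
∣p^⇒power pp zero    n∣ = 0 , z≤n , ℕ∣.∣1⇒≡1 n∣
∣p^⇒power {p} pp (suc j) {n} n∣ with p ℕ∣.∣? n
... | yes (ℕ∣.divides m refl) with i , i≤j , e ← ∣p^⇒power pp j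
        (ℕ∣.*-cancelˡ-∣ p {{prime⇒nonZero pp}} (subst (ℕ∣._∣ p ℕ.* p ℕ.^ j) (ℕₚ.*-comm m p) n∣)) =
  suc i , s≤s i≤j , trans (ℕₚ.*-comm m p) (cong (p ℕ.*_) e)
... | no p∤n with i , i≤j , e ← ∣p^⇒power pp j (coprime-divisor (prime∤⇒coprime pp p∤n) n∣) = i , ℕₚ.m≤n⇒m≤1+n i≤j , e

module PrimePowers {p : ℕ} (prime-p : Prime p) where

  1<p : 1 < p
  1<p = ℕ.nonTrivial⇒n>1 p {{prime⇒nonTrivial prime-p}}

  instance
    p≢0 : NonZero p
    p≢0 = prime⇒nonZero prime-p

    p^≢0 : ∀ {j} → NonZero (p ℕ.^ j)
    p^≢0 {j} = ℕₚ.m^n≢0 p j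

  p^-injective : ∀ {i j} → p ℕ.^ i ≡ p ℕ.^ j → i ≡ j
  p^-injective {i} {j} e with ℕₚ.<-cmp i j
  ... | tri< i<j _ _ = contradiction e (ℕₚ.<⇒≢ (ℕₚ.^-monoʳ-< p 1<p i<j))
  ... | tri≈ _ i≡j _ = i≡j
  ... | tri> _ _ j<i = contradiction (sym e) (ℕₚ.<⇒≢ (ℕₚ.^-monoʳ-< p 1<p j<i))

  -- `Φ` and `S̃` filter a range of numbers, whereas the inductions run over exponents. Both lists
  -- are free of repetitions and have the same members; their orders differ, so only a permutation
  -- can be claimed.
  filter-powers-↭ : ∀ {Q : Pred ℕ 0ℓ} (Q? : Decidable Q) {N} j →
    (∀ {n} → n < N → Q n → ∃[ i ] (i < j × n ≡ p ℕ.^ i)) → (∀ {i} → i < j → p ℕ.^ i < N) →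
    filter Q? (upTo N) ↭ map (p ℕ.^_) (filter (λ i → Q? (p ℕ.^ i)) (downFrom j))
  filter-powers-↭ {Q} Q? {N} j powers bounded = ∼bag⇒↭ (unique∧set⇒bag
    (Uniqueₚ.filter⁺ Q? (Uniqueₚ.upTo⁺ N))
    (Uniqueₚ.map⁺ p^-injective (Uniqueₚ.filter⁺ (λ i → Q? (p ℕ.^ i)) (Uniqueₚ.downFrom⁺ j)))
    (mk⇔ to from))
    where
    Q^? : Decidable (λ i → Q (p ℕ.^ i))
    Q^? = λ i → Q? (p ℕ.^ i)
    to : ∀ {n} → n ∈ filter Q? (upTo N) → n ∈ map (p ℕ.^_) (filter Q^? (downFrom j))
    to n∈ with n∈upTo , q ← ∈-filter⁻ Q? n∈ with i , i<j , refl ← powers (∈-upTo⁻ n∈upTo) q =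
      ∈-map∘filter⁺ (p ℕ.^_) Q^? (i , ∈-downFrom⁺ i<j , refl , q)
    from : ∀ {n} → n ∈ map (p ℕ.^_) (filter Q^? (downFrom j)) → n ∈ filter Q? (upTo N)
    from n∈ with i , i∈ , refl , q ← ∈-map∘filter⁻ (p ℕ.^_) Q^? n∈ = ∈-filter⁺ Q? (∈-upTo⁺ (bounded (∈-downFrom⁻ i∈))) q

  -- The closed form of the cyclotomic polynomial of index p^j, to be identified with the recursive
  -- definition in `Φ-p^`.
  Φ^ : ℕ → Poly
  Φ^ zero    = x-1
  Φ^ (suc j) = geom p (p ℕ.^ j)

  -- The quotients (x^(p^(i+1)) - 1)/(x^(p^i) - 1) telescope.
  ∏Φ^ : ∀ j → ∏ₚ (map Φ^ (downFrom (suc j))) ≋ x^ (p ℕ.^ j) ⊖1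
  ∏Φ^ zero    = 𝔸.*-identityʳ x-1
  ∏Φ^ (suc j) = 𝔸.trans (geom p (p ℕ.^ j) *ˡ ∏Φ^ j) (geom-* p (p ℕ.^ j))

-- `_÷_` returns whatever quotient the decision procedure finds. Cancelling the monic divisor pins
-- it down, and the existence of `q` rules out the default value 0.
÷-unique : ∀ {N f g h q} → Monic N h → g ≋ h → f ≋ q *ₚ h → f ÷ g ≋ q
÷-unique {f = f} {g} {h} {q} mon g≋h e with g ∣ₚ? f
... | yes (q′ , e′) = monic-cancelʳ mon q′ q (𝔸.trans (q′ *ˡ 𝔸.sym g≋h) (𝔸.trans (𝔸.sym (mk e′)) e))
... | no ∤ᴾ          = contradiction (q , at (𝔸.trans e (q *ˡ 𝔸.sym g≋h))) ∤ᴾ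

Φ≤-stable : ∀ N {d} → d ≤ N → Φ≤ N d ≡ Φ d
Φ≤-stable N       d≤N with ℕₚ.m≤n⇒m<n∨m≡n d≤N
Φ≤-stable N       d≤N | inj₂ refl = refl
Φ≤-stable (suc N) {d} d≤N | inj₁ d<1+N with d ℕ.≟ suc N
... | yes d≡1+N = contradiction d≡1+N (ℕₚ.<⇒≢ d<1+N)
... | no  _     = Φ≤-stable N (ℕ.s≤s⁻¹ d<1+N)

Φ-unfold : ∀ n .{{_ : NonZero n}} → Φ n ≡ (x^ n ⊖1) ÷ ∏ₚ (map Φ (filter (ℕ∣._∣? n) (upTo n)))
Φ-unfold (suc N) with suc N ℕ.≟ suc N
... | no  N≢N = contradiction refl N≢N
... | yes _   = cong (λ fs → (x^ (suc N) ⊖1) ÷ ∏ₚ fs) (map-cong-local (All.tabulate λ n∈ →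
  Φ≤-stable N (ℕ.s≤s⁻¹ (∈-upTo⁻ (proj₁ (∈-filter⁻ (ℕ∣._∣? suc N) n∈))))))

module _ {p : ℕ} (prime-p : Prime p) where
  open PrimePowers prime-p

  ∏Φ^-monic : ∀ j → ∃[ N ] Monic N (∏ₚ (map Φ^ (downFrom j)))
  ∏Φ^-monic zero    = 0 , x^-monic 0
  ∏Φ^-monic (suc j) = p ℕ.^ j , monic-resp (𝔸.sym (∏Φ^ j)) (x^⊖1-monic (p ℕ.^ j) {{p^≢0 {j}}})

  p^∣p^ : ∀ {i j} → i ≤ j → p ℕ.^ i ℕ∣.∣ p ℕ.^ j
  p^∣p^ {i} {j} i≤j = ℕ∣.divides (p ℕ.^ (j ℕ.∸ i)) (trans (cong (p ℕ.^_) (sym (ℕₚ.m∸n+n≡m i≤j))) (ℕₚ.^-distribˡ-+-* p (j ℕ.∸ i) i))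

  proper-divisors-↭ : ∀ j → filter (ℕ∣._∣? p ℕ.^ j) (upTo (p ℕ.^ j)) ↭ map (p ℕ.^_) (downFrom j)
  proper-divisors-↭ j = subst (λ is → filter (ℕ∣._∣? p ℕ.^ j) (upTo (p ℕ.^ j)) ↭ map (p ℕ.^_) is)
    (filter-all (λ i → p ℕ.^ i ℕ∣.∣? p ℕ.^ j) (All.tabulate λ {i} i∈ → p^∣p^ {i} {j} (ℕₚ.<⇒≤ (∈-downFrom⁻ i∈))))
    (filter-powers-↭ (ℕ∣._∣? p ℕ.^ j) j proper (ℕₚ.^-monoʳ-< p 1<p))
    where
    proper : ∀ {n} → n < p ℕ.^ j → n ℕ∣.∣ p ℕ.^ j → ∃[ i ] (i < j × n ≡ p ℕ.^ i)
    proper n<p^j n∣ with ∣p^⇒power prime-p j n∣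
    ... | i , i≤j , e with ℕₚ.m≤n⇒m<n∨m≡n i≤j
    ...   | inj₁ i<j  = i , i<j , e
    ...   | inj₂ refl = contradiction e (ℕₚ.<⇒≢ n<p^j)

  -- The product over the proper divisors is known by induction and is monic, so the division in the
  -- definition of `Φ` has only one outcome.
  Φ-p^ : ∀ j → Φ (p ℕ.^ j) ≋ Φ^ j
  Φ-p^ = <-rec _ λ j rec → 𝔸.trans (𝔸.reflexive (Φ-unfold (p ℕ.^ j) {{p^≢0 {j}}}))
    (÷-unique (proj₂ (∏Φ^-monic j)) (begin
      ∏ₚ (map Φ (filter (ℕ∣._∣? p ℕ.^ j) (upTo (p ℕ.^ j))))
        ≈⟨ ∏ₚ-↭ (↭ₚ.map⁺ Φ (proper-divisors-↭ j)) ⟩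
      ∏ₚ (map Φ (map (p ℕ.^_) (downFrom j)))
        ≡⟨ cong ∏ₚ (map-∘ (downFrom j)) ⟨
      ∏ₚ (map (Φ ∘ (p ℕ.^_)) (downFrom j))
        ≈⟨ ∏ₚ-cong (All.tabulate λ i∈ → rec (∈-downFrom⁻ i∈)) ⟩
      ∏ₚ (map Φ^ (downFrom j)) ∎)
      (𝔸.sym (∏Φ^ j)))
    where open ≋-Reasoning

x^-as-^ : ∀ n → (x-1 +ₚ 1ₚ) ^ₚ n ≋ x^ n
x^-as-^ zero    = 𝔸.refl
x^-as-^ (suc n) = 𝔸.trans (𝔸.*-cong x-1+1 (x^-as-^ n)) (𝔸.sym (x^-+ 1 n))
  where
  x-1+1 : x-1 +ₚ 1ₚ ≋ x^ 1
  x-1+1 = mk λ { zero → refl ; (suc zero) → refl ; (suc (suc _)) → refl }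

∣-- : ∀ {f g h} → h ∣ᴾ f → h ∣ᴾ g → h ∣ᴾ f -ₚ g
∣-- {f} {g} {h} d (q , e) = ∣-+ d (-1ℤ ·ₚ q , 𝔸.trans
  (solve 2 (λ q h → (⊝ q ⊗ h) ⊜ (⊝ (q ⊗ h))) 𝔸.refl q h) (𝔸.-‿cong e))

-- Modulo x^m - 1 every power of x^m is 1.
geom-≡-κ : ∀ k m → x^ m ⊖1 ∣ᴾ geom k m -ₚ κ (+ k)
geom-≡-κ zero    m = [] , mk λ { zero → refl ; (suc _) → refl }
geom-≡-κ (suc k) m = ∣-resp (∣-+ (geom-≡-κ k m) (x^-1-∣ k m)) (𝔸.trans
  (solve 3 (λ g c y → (g ⊕ ⊝ c ⊕ (y ⊕ ⊝ Κ 1ₚ)) ⊜ (g ⊕ y ⊕ ⊝ (Κ 1ₚ ⊕ c))) 𝔸.refl (geom k m) (κ (+ k)) (x^ (k ℕ.* m)))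
  𝔸.refl)

x^⊖1-∣ : ∀ {m n} → m ℕ∣.∣ n → x^ m ⊖1 ∣ᴾ x^ n ⊖1
x^⊖1-∣ {m} (ℕ∣.divides k refl) = x^-1-∣ k m

module _ {p : ℕ} (prime-p : Prime p) where
  open PrimePowers prime-p

  -- For n = p^(j+1), Frobenius gives x^n - 1 ≡ (x - 1)^n modulo p, and x^n - 1 is a multiple of
  -- Φ_n.
  ramified : ∀ j → x-1 ^ₚ (p ℕ.^ suc j) ∈⟨ κ (+ p) , Φ^ (suc j) ⟩
  ramified j = from (freshman-^ prime-p x-1 (suc j))
    where
    open ≋-Reasoning
    n = p ℕ.^ suc j
    from : (x-1 +ₚ 1ₚ) ^ₚ n ≡ x-1 ^ₚ n +ₚ 1ₚ [mod κ (+ p) ] → x-1 ^ₚ n ∈⟨ κ (+ p) , Φ^ (suc j) ⟩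
    from (congruent {t} e) = combination {s = -1ℤ ·ₚ t} {t = x^ (p ℕ.^ j) ⊖1} (begin
      x-1 ^ₚ n
        ≈⟨ solve 2 (λ y z → y ⊜ (⊝ z ⊕ (y ⊕ Κ 1ₚ ⊕ z ⊕ ⊝ Κ 1ₚ))) 𝔸.refl (x-1 ^ₚ n) (t *ₚ κ (+ p)) ⟩
      -1ℤ ·ₚ (t *ₚ κ (+ p)) +ₚ (x-1 ^ₚ n +ₚ 1ₚ +ₚ t *ₚ κ (+ p) -ₚ 1ₚ)
        ≈⟨ -1ℤ ·ₚ (t *ₚ κ (+ p)) +ˡ (𝔸.trans (𝔸.sym e) (x^-as-^ n) +ʳ (-1ℤ ·ₚ 1ₚ)) ⟩
      -1ℤ ·ₚ (t *ₚ κ (+ p)) +ₚ x^ n ⊖1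
        ≈⟨ -1ℤ ·ₚ (t *ₚ κ (+ p)) +ˡ geom-* p (p ℕ.^ j) ⟨
      -1ℤ ·ₚ (t *ₚ κ (+ p)) +ₚ Φ^ (suc j) *ₚ x^ (p ℕ.^ j) ⊖1
        ≈⟨ solve 4 (λ t k g y → (⊝ (t ⊗ k) ⊕ g ⊗ y) ⊜ (⊝ t ⊗ k ⊕ y ⊗ g)) 𝔸.refl t (κ (+ p)) (Φ^ (suc j)) (x^ (p ℕ.^ j) ⊖1) ⟩
      (-1ℤ ·ₚ t) *ₚ κ (+ p) +ₚ x^ (p ℕ.^ j) ⊖1 *ₚ Φ^ (suc j) ∎)

  degree-Φ^ : ℕ → ℕ
  degree-Φ^ j = ℕ.pred p ℕ.* p ℕ.^ j

  Φ^-monic : ∀ j → Monic (degree-Φ^ j) (Φ^ (suc j))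
  Φ^-monic j = subst (λ q → Monic (degree-Φ^ j) (geom q (p ℕ.^ j))) (ℕₚ.suc-pred p)
    (geom-monic (ℕ.pred p) (p ℕ.^ j) {{p^≢0 {j}}})

  module Φ-Eisenstein (j : ℕ) = Eisenstein {K = p ℕ.^ suc j} prime-p (Φ^-monic j) (ev₁-geom p (p ℕ.^ j)) (ramified j)

  -- The degree (p - 1) p^j is positive and the polynomial is monic, so among constants it divides
  -- only 0.
  Φ^∤κp : ∀ j → Φ^ (suc j) ∤ᴾ κ (+ p)
  Φ^∤κp j d = contradiction (ℤₚ.+-injective (at (monic-∣⇒≋[] (Φ^-monic j) constant d) 0)) (ℕ.≢-nonZero⁻¹ p)
    where
    0<degree : 0 < degree-Φ^ j
    0<degree = ℕₚ.*-mono-≤ {1} (ℕₚ.≤-trans (ℕ.s≤s⁻¹ (subst (2 ≤_) (sym (ℕₚ.suc-pred p)) 1<p)) ℕₚ.≤-refl) (ℕ.>-nonZero⁻¹ (p ℕ.^ j) {{p^≢0 {j}}})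
    constant : VanishesFrom (degree-Φ^ j) (κ (+ p))
    constant zero    q = contradiction q (ℕₚ.<⇒≱ 0<degree)
    constant (suc i) q = refl

  Φ^-∣-x^⊖1 : ∀ {i j} → i < j → Φ^ (suc i) ∣ᴾ x^ (p ℕ.^ j) ⊖1
  Φ^-∣-x^⊖1 {i} {j} i<j = ∣ʳ-trans
    (∣-resp (x∣xy (Φ^ (suc i)) (x^ (p ℕ.^ i) ⊖1)) (geom-* p (p ℕ.^ i)))
    (x^⊖1-∣ (p^∣p^ prime-p {suc i} {j} i<j))

  -- For i ≠ j the ideal generated by Φ_{p^i} and Φ_{p^j} contains p.
  Φ^-∤-Φ^ : ∀ {i j} → i ≢ j → Φ^ (suc i) ∤ᴾ Φ^ (suc j)
  Φ^-∤-Φ^ {i} {j} i≢j d with ℕₚ.<-cmp i j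
  ... | tri≈ _ i≡j _ = i≢j i≡j
  ... | tri< i<j _ _ = Φ^∤κp i (∣-resp (∣-- d (∣ʳ-trans (Φ^-∣-x^⊖1 i<j) (geom-≡-κ p (p ℕ.^ j))))
    (solve 2 (λ g c → (g ⊕ ⊝ (g ⊕ ⊝ c)) ⊜ c) 𝔸.refl (Φ^ (suc j)) (κ (+ p))))
  -- Here the assumed divisibility makes `Φ^ (suc i)` a divisor of x^(p^i) - 1, modulo which it is
  -- itself the constant p.
  ... | tri> _ _ j<i = Φ^∤κp i (∣-resp
    (∣-- (x∣xy (Φ^ (suc i)) 1ₚ) (∣ʳ-trans (∣ʳ-trans d (Φ^-∣-x^⊖1 j<i)) (geom-≡-κ p (p ℕ.^ i))))
    (solve 2 (λ g c → (g ⊗ Κ 1ₚ ⊕ ⊝ (g ⊕ ⊝ c)) ⊜ c) 𝔸.refl (Φ^ (suc i)) (κ (+ p))))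

ev₁-Φ : ∀ {p} → Prime p → ∀ j → ev₁ (Φ (p ℕ.^ suc j)) ≡ + p
ev₁-Φ {p} pp j = trans (ev₁-cong (Φ-p^ pp (suc j))) (ev₁-geom p (p ℕ.^ j))

∣-respˡ : ∀ {f g h} → f ≋ g → f ∣ᴾ h → g ∣ᴾ h
∣-respˡ e (q , d) = q , 𝔸.trans (q *ˡ 𝔸.sym e) d

Φ-prime : ∀ {n} → PrimePower n → ∀ f g → Φ n ∣ᴾ f *ₚ g → Φ n ∣ᴾ f ⊎ Φ n ∣ᴾ g
Φ-prime (p , suc j , pp , _ , refl) f g d = Sum.map (∣-respˡ (𝔸.sym e)) (∣-respˡ (𝔸.sym e))
  (Φ-Eisenstein.prime pp j f g (∣-respˡ e d))
  where e = Φ-p^ pp (suc j)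

-- For different primes p and q the values at 1 already forbid it: p would divide q.
Φ-∤-Φ : ∀ {m n} → PrimePower m → PrimePower n → m ≢ n → Φ m ∤ᴾ Φ n
Φ-∤-Φ (p , suc i , pp , _ , refl) (q , suc j , qq , _ , refl) m≢n d with p ℕ.≟ q
... | yes refl = Φ^-∤-Φ^ pp {i} {j} (λ i≡j → m≢n (cong (λ i → p ℕ.^ suc i) i≡j))
        (∣-resp (∣-respˡ (Φ-p^ pp (suc i)) d) (Φ-p^ pp (suc j)))
... | no p≢q with prime⇒irreducible qq (ℤ∣.∣⇒∣ᵤ (subst₂ ℤ∣._∣_ (ev₁-Φ pp i) (ev₁-Φ qq j) (ev₁-∣ d)))
...   | inj₁ p≡1 = contradiction p≡1 (ℕₚ.>⇒≢ (ℕ.nonTrivial⇒n>1 p {{prime⇒nonTrivial pp}}))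
...   | inj₂ p≡q = p≢q p≡q

-- Φ_n divides x^P - 1, which is this geometric sum times x - 1, and x - 1 is regular modulo Φ_n.
Φ-∣-geom : ∀ {n P} → PrimePower n → n ℕ∣.∣ P → Φ n ∣ᴾ geom P 1
Φ-∣-geom {P = P} (p , suc j , pp , _ , refl) n∣P = ∣-respˡ (𝔸.sym (Φ-p^ pp (suc j)))
  (Φ-Eisenstein.x-1-regular pp j (geom P 1) (∣-resp
    (∣ʳ-trans (Φ^-∣-x^⊖1 pp (ℕₚ.n<1+n j)) (x^⊖1-∣ n∣P))
    (𝔸.sym (subst (λ m → geom P 1 *ₚ x-1 ≋ x^ m ⊖1) (ℕₚ.*-identityʳ P) (geom-* P 1)))))
  where open PrimePowers pp

-- This stands in for a coprimality argument. In f = q Φ_n every other Φ_m is prime and does not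
-- divide Φ_n, hence divides the cofactor `q`.
∏Φ-∣ : ∀ {ns f} → Unique ns → All PrimePower ns → All (λ n → Φ n ∣ᴾ f) ns → ∏ₚ (map Φ ns) ∣ᴾ f
∏Φ-∣ {f = f} [] [] [] = f , 𝔸.*-identityʳ f
∏Φ-∣ {n ∷ ns} {f} (n∉ns ∷ uniq) (pn ∷ pns) ((q , e) ∷ ds) = ∣-resp (extend (∏Φ-∣ uniq pns (descend n∉ns pns ds))) (𝔸.trans (*ₚ-comm (Φ n) q) e)
  where
  extend : ∏ₚ (map Φ ns) ∣ᴾ q → Φ n *ₚ ∏ₚ (map Φ ns) ∣ᴾ Φ n *ₚ q
  extend (r , d) = r , 𝔸.trans (solve 3 (λ r y z → (r ⊗ (y ⊗ z)) ⊜ (y ⊗ (r ⊗ z))) 𝔸.refl r (Φ n) (∏ₚ (map Φ ns))) (Φ n *ˡ d)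
  descend : ∀ {ms} → All (n ≢_) ms → All PrimePower ms → All (λ m → Φ m ∣ᴾ f) ms → All (λ m → Φ m ∣ᴾ q) ms
  descend [] [] [] = []
  descend {m ∷ _} (n≢m ∷ n∉) (pm ∷ pms) (d ∷ ds) =
    Sum.[ (λ d → d) , (λ m∣n → contradiction m∣n (Φ-∤-Φ pm pn (n≢m ∘ sym))) ]′ (Φ-prime pm q (Φ n) (∣-resp d (𝔸.sym e)))
    ∷ descend n∉ pms ds

-- Perfect colourings as an equation for the indicator sequence

remainder-unique : ∀ {P r s} i j → r < P → s < P → + r ℤ.+ i ℤ.* + P ≡ + s ℤ.+ j ℤ.* + P → r ≡ s
remainder-unique {P} {r} {s} i j r<P s<P e = ℤₚ.+-injective (ℤₚ.i-j≡0⇒i≡j (+ r) (+ s)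
  (ℤₚ.∣i∣≡0⇒i≡0 (∣∧<⇒≡0 (ℤ∣.∣⇒∣ᵤ (ℤ∣.divides (j ℤ.- i) difference)) small)))
  where
  eq₁ : ∀ r s x → r ℤ.- s ≡ (r ℤ.+ x) ℤ.- (s ℤ.+ x)
  eq₁ = solve-∀
  eq₂ : ∀ s i j P → (s ℤ.+ j ℤ.* P) ℤ.- (s ℤ.+ i ℤ.* P) ≡ (j ℤ.- i) ℤ.* P
  eq₂ = solve-∀
  difference : + r ℤ.- + s ≡ (j ℤ.- i) ℤ.* + P
  difference = trans (eq₁ (+ r) (+ s) (i ℤ.* + P))
    (trans (cong (ℤ._- (+ s ℤ.+ i ℤ.* + P)) e) (eq₂ (+ s) i j (+ P)))
  small : ℤ.∣ + r ℤ.- + s ∣ < P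
  small = subst (_< P) (cong ℤ.∣_∣ (sym (ℤₚ.m-n≡m⊖n r s)))
    (ℕₚ.≤-<-trans (ℤₚ.∣m⊝n∣≤m⊔n r s) (ℕₚ.⊔-lub r<P s<P))

modFin-cong : ∀ P .{{_ : NonZero P}} y z k → y ≡ z ℤ.+ k ℤ.* + P → y modFin P ≡ z modFin P
modFin-cong P y z k e = Finₚ.fromℕ<-cong _ _ (remainder-unique (y /ℕ P) (z /ℕ P ℤ.+ k) (n%ℕd<d y P) (n%ℕd<d z P)
  (trans (sym (a≡a%ℕn+[a/ℕn]*n y P)) (trans e (trans (cong (ℤ._+ k ℤ.* + P) (a≡a%ℕn+[a/ℕn]*n z P))
    (eq (+ (z %ℕ P)) (z /ℕ P) k (+ P)))))) _ _
  where
  eq : ∀ r q k P → r ℤ.+ q ℤ.* P ℤ.+ k ℤ.* P ≡ r ℤ.+ (q ℤ.+ k) ℤ.* P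
  eq = solve-∀

modFin-toℕ : ∀ P .{{_ : NonZero P}} (v : Fin P) → (+ toℕ v) modFin P ≡ v
modFin-toℕ P v = Finₚ.toℕ-injective (trans (Finₚ.toℕ-fromℕ< _) (m<n⇒m%n≡m (Finₚ.toℕ<n v)))

indicator : Colour → ℤ
indicator black = 1ℤ
indicator white = 0ℤ

∑ : List ℤ → ℤ
∑ = foldr ℤ._+_ 0ℤ

module _ {V : Set} (col : V → Colour) where

  #black : ∀ vs → + length (filter (λ v → col v ≟ᶜ black) vs) ≡ ∑ (map (indicator ∘ col) vs)
  #black []       = refl
  #black (v ∷ vs) with col v
  ... | black = cong (ℤ._+_ 1ℤ) (#black vs)
  ... | white = trans (#black vs) (sym (ℤₚ.+-identityˡ _))

  #black+#white : ∀ vs →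
    length (filter (λ v → col v ≟ᶜ black) vs) ℕ.+ length (filter (λ v → col v ≟ᶜ white) vs) ≡ length vs
  #black+#white []       = refl
  #black+#white (v ∷ vs) with col v
  ... | black = cong suc (#black+#white vs)
  ... | white = trans (ℕₚ.+-suc _ _) (cong suc (#black+#white vs))

length-C∞ : ∀ {k} (l : Vec ℕ k) g → length (C∞ l g) ≡ 2 ℕ.* k
length-C∞ []              g = refl
length-C∞ {suc k} (_ ∷ l) g = trans (cong (ℕ._+_ 2) (length-C∞ l g)) (sym (ℕₚ.*-suc 2 k))

maxᵥ-bound : ∀ {k} (l : Vec ℕ k) {m} → maxᵥ l ≤ m → All (_≤ m) (toList l)
maxᵥ-bound []      _   = []
maxᵥ-bound (x ∷ l) ≤m = ℕₚ.≤-trans (ℕₚ.m≤m⊔n x (maxᵥ l)) ≤m ∷ maxᵥ-bound l (ℕₚ.≤-trans (ℕₚ.m≤n⊔m x (maxᵥ l)) ≤m)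

module Colouring {k} (P : ℕ) .{{_ : NonZero P}} (l : Vec ℕ k) (b c : ℕ) (col : Fin P → Colour) where

  isBlack : ℤ → ℤ
  isBlack z = indicator (col (z modFin P))

  colourSequence : Sequence
  colourSequence n = isBlack (+ n)

  private
    M = maxᵥ l
    u = colourSequence

  -- `g` may be any integer congruent to n + M, since the graph lists neighbours of the
  -- representative `toℕ v`. The offset `M` keeps the positions n + M - lᵢ in ℕ, where sequences
  -- live.
  neighbour-sum : ∀ {ls} n g q → + (n ℕ.+ M) ≡ g ℤ.+ q ℤ.* + P → All (_≤ M) ls →
    (∑ₚ (map (λ lᵢ → x^ (M ℕ.+ lᵢ) +ₚ x^ (M ∸ lᵢ)) ls) ⋆ u) n
      ≡ ∑ (map isBlack (concatMap (λ lᵢ → (g ℤ.+ + lᵢ) ∷ (g ℤ.- + lᵢ) ∷ []) ls))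
  neighbour-sum n g q e [] = refl
  neighbour-sum {lᵢ ∷ ls} n g q e (lᵢ≤M ∷ ls≤M) = begin
    ((x^ (M ℕ.+ lᵢ) +ₚ x^ (M ∸ lᵢ) +ₚ rest) ⋆ u) n
      ≡⟨ +-⋆ (x^ (M ℕ.+ lᵢ) +ₚ x^ (M ∸ lᵢ)) rest u n ⟩
    ((x^ (M ℕ.+ lᵢ) +ₚ x^ (M ∸ lᵢ)) ⋆ u) n ℤ.+ (rest ⋆ u) n
      ≡⟨ cong₂ ℤ._+_ (+-⋆ (x^ (M ℕ.+ lᵢ)) (x^ (M ∸ lᵢ)) u n) (neighbour-sum n g q e ls≤M) ⟩
    (x^ (M ℕ.+ lᵢ) ⋆ u) n ℤ.+ (x^ (M ∸ lᵢ) ⋆ u) n ℤ.+ tail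
      ≡⟨ cong (ℤ._+ tail) (cong₂ ℤ._+_ (trans (x^-⋆ (M ℕ.+ lᵢ) u n) plus) (trans (x^-⋆ (M ∸ lᵢ) u n) minus)) ⟩
    isBlack (g ℤ.+ + lᵢ) ℤ.+ isBlack (g ℤ.- + lᵢ) ℤ.+ tail
      ≡⟨ ℤₚ.+-assoc (isBlack (g ℤ.+ + lᵢ)) _ _ ⟩
    isBlack (g ℤ.+ + lᵢ) ℤ.+ (isBlack (g ℤ.- + lᵢ) ℤ.+ tail) ∎
    where
    open ≡-Reasoning
    rest = ∑ₚ (map (λ lᵢ → x^ (M ℕ.+ lᵢ) +ₚ x^ (M ∸ lᵢ)) ls)
    tail = ∑ (map isBlack (concatMap (λ lᵢ → (g ℤ.+ + lᵢ) ∷ (g ℤ.- + lᵢ) ∷ []) ls))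
    eq : ∀ g q l → g ℤ.+ q ℤ.+ l ≡ g ℤ.+ l ℤ.+ q
    eq = solve-∀
    plus : u (n ℕ.+ (M ℕ.+ lᵢ)) ≡ isBlack (g ℤ.+ + lᵢ)
    plus = cong (indicator ∘ col) (modFin-cong P _ (g ℤ.+ + lᵢ) q (trans
      (trans (cong +_ (sym (ℕₚ.+-assoc n M lᵢ))) (cong (ℤ._+ + lᵢ) e))
      (eq g (q ℤ.* + P) (+ lᵢ))))
    minus : u (n ℕ.+ (M ∸ lᵢ)) ≡ isBlack (g ℤ.- + lᵢ)
    minus = cong (indicator ∘ col) (modFin-cong P _ (g ℤ.- + lᵢ) q (trans
      (trans (cong +_ (sym (ℕₚ.+-∸-assoc n lᵢ≤M)))
        (trans (sym (ℤₚ.⊖-≥ (ℕₚ.≤-trans lᵢ≤M (ℕₚ.m≤n+m M n)))) (trans (sym (ℤₚ.m-n≡m⊖n (n ℕ.+ M) lᵢ)) (cong (ℤ._- + lᵢ) e))))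
      (eq g (q ℤ.* + P) (ℤ.- + lᵢ))))

  #black-at #white-at : Fin P → ℕ
  #black-at = #neighbours (C P l) col black
  #white-at = #neighbours (C P l) col white

  -- Because of the factor x^M, entry `n` speaks of the vertex n + M modulo `P`.
  A-⋆ : ∀ n v q → + (n ℕ.+ M) ≡ + toℕ v ℤ.+ q ℤ.* + P →
    (A l b c ⋆ u) n ≡ (+ b ℤ.+ + c ℤ.- + (2 ℕ.* k)) ℤ.* indicator (col v) ℤ.+ + #black-at v
  A-⋆ n v q e = trans (+-⋆ (d ·ₚ x^ M) _ u n) (cong₂ ℤ._+_
    (trans (·-⋆ d (x^ M) u n) (cong (d ℤ.*_) (trans (x^-⋆ M u n)
      (cong (indicator ∘ col) (trans (modFin-cong P _ (+ toℕ v) q e) (modFin-toℕ P v))))))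
    (trans (neighbour-sum n (+ toℕ v) q e (maxᵥ-bound l ℕₚ.≤-refl))
      (sym (trans (#black col (C P l v)) (cong ∑ (sym (map-∘ (C∞ l (+ toℕ v)))))))))
    where
    d = + b ℤ.+ + c ℤ.- + (2 ℕ.* k)

  degree-sum : ∀ v → #black-at v ℕ.+ #white-at v ≡ 2 ℕ.* k
  degree-sum v = trans (#black+#white col (C P l v)) (trans (length-map (_modFin P) (C∞ l (+ toℕ v))) (length-C∞ l (+ toℕ v)))

  -- The term -2k turns the count of black neighbours into minus the count of white ones, so the
  -- value is `c` exactly if there are `b` white neighbours.
  at-black : ∀ v → (+ b ℤ.+ + c ℤ.- + (2 ℕ.* k)) ℤ.* 1ℤ ℤ.+ + #black-at v ≡ + c ℤ.+ (+ b ℤ.- + #white-at v)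
  at-black v = trans
    (cong (λ d → (+ b ℤ.+ + c ℤ.- + d) ℤ.* 1ℤ ℤ.+ + #black-at v) (sym (degree-sum v)))
    (eq (+ b) (+ c) (+ #black-at v) (+ #white-at v))
    where
    eq : ∀ b c x y → (b ℤ.+ c ℤ.- (x ℤ.+ y)) ℤ.* 1ℤ ℤ.+ x ≡ c ℤ.+ (b ℤ.- y)
    eq = solve-∀

  at-white : ∀ v → (+ b ℤ.+ + c ℤ.- + (2 ℕ.* k)) ℤ.* 0ℤ ℤ.+ + #black-at v ≡ + #black-at v
  at-white v = trans (cong (ℤ._+ + #black-at v) (ℤₚ.*-zeroʳ (+ b ℤ.+ + c ℤ.- + (2 ℕ.* k)))) (ℤₚ.+-identityˡ _)

  perfect⇒⋆ : IsPerfectColouring (C P l) b c col → ∀ n → (A l b c ⋆ u) n ≡ + c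
  perfect⇒⋆ perfect n = trans (A-⋆ n v (+ ((n ℕ.+ M) ℕ/./ P)) position) (at-vertex (col v) refl)
    where
    open IsPerfectColouring perfect
    v = (+ (n ℕ.+ M)) modFin P
    position : + (n ℕ.+ M) ≡ + toℕ v ℤ.+ + ((n ℕ.+ M) ℕ/./ P) ℤ.* + P
    position = trans (cong +_ (m≡m%n+[m/n]*n (n ℕ.+ M) P))
      (cong₂ ℤ._+_ (cong +_ (sym (Finₚ.toℕ-fromℕ< _))) (ℤₚ.pos-* ((n ℕ.+ M) ℕ/./ P) P))
    at-vertex : ∀ x → col v ≡ x → (+ b ℤ.+ + c ℤ.- + (2 ℕ.* k)) ℤ.* indicator (col v) ℤ.+ + #black-at v ≡ + c
    at-vertex black e = trans (cong (λ x → (+ b ℤ.+ + c ℤ.- + (2 ℕ.* k)) ℤ.* indicator x ℤ.+ + #black-at v) e)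
      (trans (at-black v) (trans (cong (ℤ._+_ (+ c)) (ℤₚ.i≡j⇒i-j≡0 {+ b} {+ #white-at v} (cong +_ (sym (black-vertices v e)))))
        (ℤₚ.+-identityʳ (+ c))))
    at-vertex white e = trans (cong (λ x → (+ b ℤ.+ + c ℤ.- + (2 ℕ.* k)) ℤ.* indicator x ℤ.+ + #black-at v) e)
      (trans (at-white v) (cong +_ (white-vertices v e)))

  ⋆⇒perfect : (∀ n → (A l b c ⋆ u) n ≡ + c) → IsPerfectColouring (C P l) b c col
  ⋆⇒perfect h = record
    { black-vertices = λ v e → ℤₚ.+-injective (sym (ℤₚ.i-j≡0⇒i≡j (+ b) (+ #white-at v)
        (ℤ-group.∙-cancelˡ (+ c) _ _ (trans (sym (at-black v)) (trans (at-vertex v black e) (sym (ℤₚ.+-identityʳ (+ c))))))))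
    ; white-vertices = λ v e → ℤₚ.+-injective (trans (sym (at-white v)) (at-vertex v white e))
    }
    where
    at-vertex : ∀ v x → col v ≡ x → (+ b ℤ.+ + c ℤ.- + (2 ℕ.* k)) ℤ.* indicator x ℤ.+ + #black-at v ≡ + c
    at-vertex v x e = trans (cong (λ x → (+ b ℤ.+ + c ℤ.- + (2 ℕ.* k)) ℤ.* indicator x ℤ.+ + #black-at v) (sym e))
      (trans (sym (A-⋆ n v (+ M) position)) (h n))
      where
      -- An index whose entry speaks of `v`, found without subtraction: n + M = toℕ v + M P.
      n = toℕ v ℕ.+ M ℕ.* ℕ.pred P
      position : + (n ℕ.+ M) ≡ + toℕ v ℤ.+ + M ℤ.* + P
      position = trans (cong +_ (trans (ℕₚ.+-assoc (toℕ v) _ M) (cong (ℕ._+_ (toℕ v))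
        (trans (ℕₚ.+-comm _ M) (trans (sym (ℕₚ.*-suc M (ℕ.pred P))) (cong (M ℕ.*_) (ℕₚ.suc-pred P)))))))
        (cong (ℤ._+_ (+ toℕ v)) (ℤₚ.pos-* M P))

-- Necessity

-- The generating polynomial ∑_{i<n} u(i) x^(n-1-i).
gen : ℕ → Sequence → Poly
gen zero    u = []
gen (suc n) u = u n ∷ gen n u

gen-cong : ∀ n {u v} → u ≗ v → gen n u ≋ gen n v
gen-cong n {u} {v} e = 𝔸.reflexive (go n)
  where
  go : ∀ n → gen n u ≡ gen n v
  go zero    = refl
  go (suc n) = cong₂ _∷_ (e n) (go n)

gen-linear : ∀ n a u v → gen n (λ m → a ℤ.* u m ℤ.+ v m) ≋ κ a *ₚ gen n u +ₚ gen n v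
gen-linear n a u v = 𝔸.trans (mk λ i → cong (λ f → coeff f i) (go n)) (·-as-κ a (gen n u) +ʳ gen n v)
  where
  go : ∀ n → gen n (λ m → a ℤ.* u m ℤ.+ v m) ≡ a ·ₚ gen n u +ₚ gen n v
  go zero    = refl
  go (suc n) = cong (a ℤ.* u n ℤ.+ v n ∷_) (go n)

gen-0 : ∀ n → gen n (λ _ → 0ℤ) ≋ []
gen-0 zero    = 𝔸.refl
gen-0 (suc n) = mk λ { zero → refl ; (suc i) → at (gen-0 n) i }

-- Both sides are `gen (suc n) u`. The reversed order of exponents is chosen so that multiplication
-- by x is the shift: u(0) leaves at the top and u(n) enters at the bottom.
gen-shift : ∀ n u → x^ 1 *ₚ gen n u +ₚ κ (u n) ≋ gen n (u ∘ suc) +ₚ κ (u 0) *ₚ x^ n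
gen-shift zero    u = 𝔸.trans (solve 2 (λ y c → (y ⊗ Κ [] ⊕ c) ⊜ (Κ [] ⊕ c ⊗ Κ 1ₚ)) 𝔸.refl (x^ 1) (κ (u 0))) 𝔸.refl
gen-shift (suc n) u = begin
  x^ 1 *ₚ (u n ∷ gen n u) +ₚ κ (u (suc n))
    ≈⟨ x^ 1 *ˡ 𝔸.trans (∷-as-κ (u n) (gen n u)) (+ₚ-comm (κ (u n)) (x^ 1 *ₚ gen n u)) +ʳ κ (u (suc n)) ⟩
  x^ 1 *ₚ (x^ 1 *ₚ gen n u +ₚ κ (u n)) +ₚ κ (u (suc n))
    ≈⟨ x^ 1 *ˡ gen-shift n u +ʳ κ (u (suc n)) ⟩
  x^ 1 *ₚ (gen n (u ∘ suc) +ₚ κ (u 0) *ₚ x^ n) +ₚ κ (u (suc n))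
    ≈⟨ solve 5 (λ y g c z d → (y ⊗ (g ⊕ c ⊗ z) ⊕ d) ⊜ (d ⊕ y ⊗ g ⊕ c ⊗ (y ⊗ z))) 𝔸.refl
         (x^ 1) (gen n (u ∘ suc)) (κ (u 0)) (x^ n) (κ (u (suc n))) ⟩
  κ (u (suc n)) +ₚ x^ 1 *ₚ gen n (u ∘ suc) +ₚ κ (u 0) *ₚ (x^ 1 *ₚ x^ n)
    ≈⟨ 𝔸.+-cong (𝔸.sym (∷-as-κ (u (suc n)) (gen n (u ∘ suc)))) (κ (u 0) *ˡ 𝔸.sym (x^-+ 1 n)) ⟩
  gen (suc n) (u ∘ suc) +ₚ κ (u 0) *ₚ x^ (suc n) ∎
  where open ≋-Reasoning

gen-const : ∀ n c → gen n (λ _ → c) ≋ κ c *ₚ geom n 1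
gen-const n c = monic-cancelʳ x-1-monic g (κ c *ₚ geom n 1) (begin
  g *ₚ x-1
    ≈⟨ solve 3 (λ g y c → (g ⊗ (y ⊕ ⊝ Κ 1ₚ)) ⊜ ((y ⊗ g ⊕ c) ⊕ ⊝ (g ⊕ c))) 𝔸.refl g (x^ 1) (κ c) ⟩
  (x^ 1 *ₚ g +ₚ κ c) -ₚ (g +ₚ κ c)
    ≈⟨ gen-shift n (λ _ → c) +ʳ (-1ℤ ·ₚ (g +ₚ κ c)) ⟩
  (g +ₚ κ c *ₚ x^ n) -ₚ (g +ₚ κ c)
    ≈⟨ solve 3 (λ g c z → ((g ⊕ c ⊗ z) ⊕ ⊝ (g ⊕ c)) ⊜ (c ⊗ (z ⊕ ⊝ Κ 1ₚ))) 𝔸.refl g (κ c) (x^ n) ⟩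
  κ c *ₚ x^ n ⊖1
    ≈⟨ κ c *ˡ subst (λ m → geom n 1 *ₚ x-1 ≋ x^ m ⊖1) (ℕₚ.*-identityʳ n) (geom-* n 1) ⟨
  κ c *ₚ (geom n 1 *ₚ x-1)
    ≈⟨ 𝔸.*-assoc (κ c) (geom n 1) x-1 ⟨
  κ c *ₚ geom n 1 *ₚ x-1 ∎)
  where
  open ≋-Reasoning
  g = gen n (λ _ → c)

module _ (P : ℕ) where

  Periodic : Sequence → Set
  Periodic u = ∀ n → u (n ℕ.+ P) ≡ u n

  ⋆-periodic : ∀ f {u} → Periodic u → Periodic (f ⋆ u)
  ⋆-periodic []      per n = refl
  ⋆-periodic (a ∷ f) per n = cong₂ ℤ._+_ (cong (a ℤ.*_) (per n)) (⋆-periodic f per (suc n))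

  -- By periodicity the entering term u(P) is u(0), and it differs from the leaving term u(0) x^P by
  -- a multiple of x^P - 1.
  gen-periodic : ∀ {u} → Periodic u → x^ P ⊖1 ∣ᴾ x^ 1 *ₚ gen P u -ₚ gen P (u ∘ suc)
  gen-periodic {u} per = κ (u 0) , (begin
    κ (u 0) *ₚ x^ P ⊖1
      ≈⟨ solve 3 (λ g c z → (c ⊗ (z ⊕ ⊝ Κ 1ₚ)) ⊜ (g ⊕ c ⊗ z ⊕ ⊝ c ⊕ ⊝ g)) 𝔸.refl (gen P (u ∘ suc)) (κ (u 0)) (x^ P) ⟩
    gen P (u ∘ suc) +ₚ κ (u 0) *ₚ x^ P -ₚ κ (u 0) -ₚ gen P (u ∘ suc)
      ≈⟨ (𝔸.trans (𝔸.sym (gen-shift P u)) (x^ 1 *ₚ gen P u +ˡ 𝔸.reflexive (cong κ (per 0)))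
           +ʳ (-1ℤ ·ₚ κ (u 0))) +ʳ (-1ℤ ·ₚ gen P (u ∘ suc)) ⟩
    x^ 1 *ₚ gen P u +ₚ κ (u 0) -ₚ κ (u 0) -ₚ gen P (u ∘ suc)
      ≈⟨ solve 3 (λ y c g → (y ⊕ c ⊕ ⊝ c ⊕ ⊝ g) ⊜ (y ⊕ ⊝ g)) 𝔸.refl (x^ 1 *ₚ gen P u) (κ (u 0)) (gen P (u ∘ suc)) ⟩
    x^ 1 *ₚ gen P u -ₚ gen P (u ∘ suc) ∎)
    where open ≋-Reasoning

  -- `gen P` intertwines the action on periodic sequences with multiplication modulo x^P - 1;
  -- Horner's form of `f` reduces this to a single shift.
  gen-⋆ : ∀ f {u} → Periodic u → x^ P ⊖1 ∣ᴾ f *ₚ gen P u -ₚ gen P (f ⋆ u)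
  gen-⋆ []      {u} per = [] , 𝔸.sym (𝔸.-‿cong (gen-0 P))
  gen-⋆ (a ∷ f) {u} per = ∣-resp (∣-+ (∣-*ˡ (x^ 1) (gen-⋆ f per)) (gen-periodic {f ⋆ u} (⋆-periodic f per))) (begin
    x^ 1 *ₚ (f *ₚ g -ₚ gen P (f ⋆ u)) +ₚ (x^ 1 *ₚ gen P (f ⋆ u) -ₚ gen P ((f ⋆ u) ∘ suc))
      ≈⟨ solve 6 (λ y f g h s a → (y ⊗ (f ⊗ g ⊕ ⊝ h) ⊕ (y ⊗ h ⊕ ⊝ s)) ⊜ ((a ⊕ y ⊗ f) ⊗ g ⊕ ⊝ (a ⊗ g ⊕ s))) 𝔸.refl
           (x^ 1) f g (gen P (f ⋆ u)) (gen P ((f ⋆ u) ∘ suc)) (κ a) ⟩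
    (κ a +ₚ x^ 1 *ₚ f) *ₚ g -ₚ (κ a *ₚ g +ₚ gen P ((f ⋆ u) ∘ suc))
      ≈⟨ 𝔸.+-cong (𝔸.sym (∷-as-κ a f) *ʳ g) (𝔸.-‿cong (𝔸.sym (gen-linear P a u ((f ⋆ u) ∘ suc)))) ⟩
    (a ∷ f) *ₚ g -ₚ gen P ((a ∷ f) ⋆ u) ∎)
    where
    open ≋-Reasoning
    g = gen P u

∏-⊆ : ∀ {A : Set} (f : A → Poly) {xs ys} → Unique xs → xs ⊆ ys → ∏ₚ (map f xs) ∣ᴾ ∏ₚ (map f ys)
∏-⊆ f {[]} {ys} _ _ = ∏ₚ (map f ys) , 𝔸.*-identityʳ _
∏-⊆ f {x ∷ xs} (x∉xs ∷ uniq) xs⊆ys with zs₁ , zs₂ , refl ← ∈-∃++ (xs⊆ys (here refl)) =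
  ∣-resp (extend (∏-⊆ f uniq xs⊆zs)) (𝔸.sym (∏ₚ-↭ (↭ₚ.map⁺ f (↭ₚ.shift x zs₁ zs₂))))
  where
  extend : ∀ {g h} → g ∣ᴾ h → f x *ₚ g ∣ᴾ f x *ₚ h
  extend {g} (r , d) = r , 𝔸.trans (solve 3 (λ r y z → (r ⊗ (y ⊗ z)) ⊜ (y ⊗ (r ⊗ z))) 𝔸.refl r (f x) g) (f x *ˡ d)
  xs⊆zs : xs ⊆ zs₁ ++ zs₂
  xs⊆zs {y} y∈xs with ∈-++⁻ zs₁ (xs⊆ys (there y∈xs))
  ... | inj₁ y∈zs₁         = ∈-++⁺ˡ y∈zs₁
  ... | inj₂ (here refl)   = contradiction refl (All.lookup x∉xs y∈xs)
  ... | inj₂ (there y∈zs₂) = ∈-++⁺ʳ zs₁ y∈zs₂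

prime-factor : ∀ r .{{_ : NonZero r}} → r ≢ 1 → ∃[ p ] (Prime p × p ℕ∣.∣ r)
prime-factor r r≢1 with factorise r
... | record { factors = [] ; isFactorisation = e } = contradiction e r≢1
... | record { factors = p ∷ ps ; isFactorisation = e ; factorsPrime = pp ∷ _ } =
  p , pp , subst (p ℕ∣.∣_) (sym e) (ℕ∣.m∣m*n _)

-- If P / gcd(P, N) had a prime factor p, then every power of p would divide gcd(P, N).
∣-by-prime-powers : ∀ P N .{{_ : NonZero P}} → (∀ {p} e → Prime p → p ℕ.^ e ℕ∣.∣ P → p ℕ.^ e ℕ∣.∣ N) → P ℕ∣.∣ N
∣-by-prime-powers P N hyp with gcd[m,n]∣m P N
... | ℕ∣.divides r e with r ℕ.≟ 1
...   | yes refl = subst (ℕ∣._∣ N) (sym (trans e (ℕₚ.*-identityˡ _))) (gcd[m,n]∣n P N)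
...   | no r≢1   = contradiction (ℕ∣.∣⇒≤ {{g≢0}} (powers g)) (ℕₚ.<⇒≱ (m<n^m p g (ℕ.nonTrivial⇒n>1 p {{prime⇒nonTrivial pp}})))
  where
  g = gcd P N
  rg≢0 : NonZero (r ℕ.* g)
  rg≢0 = subst NonZero e (ℕ.≢-nonZero (ℕ.≢-nonZero⁻¹ P))
  g≢0 : NonZero g
  g≢0 = ℕₚ.m*n≢0⇒n≢0 r {{rg≢0}}
  factor = prime-factor r {{ℕₚ.m*n≢0⇒m≢0 r {{rg≢0}}}} r≢1
  p = proj₁ factor
  pp = proj₁ (proj₂ factor)
  powers : ∀ e → p ℕ.^ e ℕ∣.∣ g
  powers zero    = ℕ∣.1∣ g
  powers (suc k) = gcd-greatest ∣P (hyp (suc k) pp ∣P)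
    where
    ∣P : p ℕ.^ suc k ℕ∣.∣ P
    ∣P = subst (p ℕ.^ suc k ℕ∣.∣_) (sym e) (ℕ∣.*-pres-∣ (proj₂ (proj₂ factor)) (powers k))

ev₁-∏Φ : ∀ {p} → Prime p → ∀ e → ev₁ (∏ₚ (map Φ (map (λ j → p ℕ.^ suc j) (downFrom e)))) ≡ + (p ℕ.^ e)
ev₁-∏Φ pp zero    = refl
ev₁-∏Φ {p} pp (suc e) = trans (ev₁-* (Φ (p ℕ.^ suc e)) _)
  (trans (cong₂ ℤ._*_ (ev₁-Φ pp e) (ev₁-∏Φ pp e)) (sym (ℤₚ.pos-* p (p ℕ.^ e))))

-- For each prime power p^e dividing `P`, the factors of index p, ..., p^e occur in the product and
-- together have the value p^e at 1.
∏Φ-all-divisors : ∀ P ns .{{_ : NonZero P}} → (∀ {n} → PrimePower n → n ℕ∣.∣ P → n ∈ ns) → P ℕ∣.∣ ℤ.∣ ev₁ (∏ₚ (map Φ ns)) ∣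
∏Φ-all-divisors P ns all = ∣-by-prime-powers P _ λ {p} e pp p^e∣P →
  ℤ∣.∣⇒∣ᵤ (subst (ℤ∣._∣ ev₁ (∏ₚ (map Φ ns))) (ev₁-∏Φ pp e) (ev₁-∣ (∏-⊆ Φ
    (Uniqueₚ.map⁺ (λ eq → ℕₚ.suc-injective (PrimePowers.p^-injective pp eq)) (Uniqueₚ.downFrom⁺ e))
    (member pp e p^e∣P))))
  where
  member : ∀ {p} → Prime p → ∀ e → p ℕ.^ e ℕ∣.∣ P → map (λ j → p ℕ.^ suc j) (downFrom e) ⊆ ns
  member pp e p^e∣P n∈ with j , j∈ , refl ← ∈-map⁻ _ n∈ = all (_ , suc j , pp , s≤s z≤n , refl)
    (ℕ∣.∣-trans (p^∣p^ pp {suc j} {e} (∈-downFrom⁻ j∈)) p^e∣P)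

ev₁-A : ∀ {k} (l : Vec ℕ k) b c → ev₁ (A l b c) ≡ + (b ℕ.+ c)
ev₁-A {k} l b c = trans (ev₁-+ (d ·ₚ x^ M) _) (trans (cong₂ ℤ._+_
  (trans (ev₁-cong (·-as-κ d (x^ M))) (trans (ev₁-* (κ d) (x^ M)) (cong₂ ℤ._*_ (ev₁-κ d) (ev₁-x^ M))))
  (sum l))
  (eq (+ b) (+ c) (+ (2 ℕ.* k))))
  where
  M = maxᵥ l
  d = + b ℤ.+ + c ℤ.- + (2 ℕ.* k)
  eq : ∀ b c k → (b ℤ.+ c ℤ.- k) ℤ.* 1ℤ ℤ.+ k ≡ b ℤ.+ c
  eq = solve-∀
  sum : ∀ {k} (l : Vec ℕ k) → ev₁ (∑ₚ (map (λ lᵢ → x^ (M ℕ.+ lᵢ) +ₚ x^ (M ∸ lᵢ)) (toList l))) ≡ + (2 ℕ.* k)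
  sum []              = refl
  sum {suc k} (x ∷ l) = trans (ev₁-+ (x^ (M ℕ.+ x) +ₚ x^ (M ∸ x)) _) (trans
    (cong₂ ℤ._+_ (trans (ev₁-+ (x^ (M ℕ.+ x)) (x^ (M ∸ x))) (cong₂ ℤ._+_ (ev₁-x^ (M ℕ.+ x)) (ev₁-x^ (M ∸ x)))) (sum l))
    (cong +_ (sym (ℕₚ.*-suc 2 k))))

module _ (b c : ℕ) .{{b≢0 : NonZero b}} where

  private
    g = gcd b c
    instance
      g≢0 : NonZero g
      g≢0 = ℕ.≢-nonZero (gcd[m,n]≢0 b c (inj₁ (ℕ.≢-nonZero⁻¹ b)))
    b+c≡ : [ b + c ]/gcd ℕ.* g ≡ b ℕ.+ c
    b+c≡ = m/n*n≡m (ℕ∣.∣m∣n⇒∣m+n (gcd[m,n]∣m b c) (gcd[m,n]∣n b c))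
    c≡ : c ℕ/./ g ℕ.* g ≡ c
    c≡ = m/n*n≡m (gcd[m,n]∣n b c)
    rearrange : ∀ S → c ℕ/./ g ℕ.* S ℕ.* g ≡ c ℕ.* S
    rearrange S = trans (ℕₚ.*-assoc (c ℕ/./ g) S g) (trans (cong (c ℕ/./ g ℕ.*_) (ℕₚ.*-comm S g))
      (trans (sym (ℕₚ.*-assoc (c ℕ/./ g) g S)) (cong (ℕ._* S) c≡)))

  -- After the gcd is cancelled, (b + c)/g is coprime to c/g, because b/g is.
  /gcd-∣⁺ : ∀ {S} → b ℕ.+ c ℕ∣.∣ c ℕ.* S → [ b + c ]/gcd ℕ∣.∣ S
  /gcd-∣⁺ {S} d = coprime-divisor (subst (λ m → Coprime m (c ℕ/./ g)) (sym split) (swap (coprime-+ (coprime-/gcd b c))))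
    (ℕ∣.*-cancelʳ-∣ g (subst₂ ℕ∣._∣_ (sym b+c≡) (sym (rearrange S)) d))
    where
    split : [ b + c ]/gcd ≡ b ℕ/./ g ℕ.+ c ℕ/./ g
    split = ℕ/.+-distrib-/-∣ˡ c (gcd[m,n]∣m b c)
    swap : Coprime (c ℕ/./ g ℕ.+ b ℕ/./ g) (c ℕ/./ g) → Coprime (b ℕ/./ g ℕ.+ c ℕ/./ g) (c ℕ/./ g)
    swap = subst (λ m → Coprime m (c ℕ/./ g)) (ℕₚ.+-comm (c ℕ/./ g) (b ℕ/./ g))

  /gcd-∣⁻ : ∀ {S} → [ b + c ]/gcd ℕ∣.∣ S → b ℕ.+ c ℕ∣.∣ c ℕ.* S
  /gcd-∣⁻ {S} d = subst₂ ℕ∣._∣_ b+c≡ (rearrange S) (ℕ∣.*-monoˡ-∣ g (ℕ∣.∣n⇒∣m*n (c ℕ/./ g) d))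

module Necessity (P : ℕ) .{{_ : NonZero P}} (f : Poly) (b c : ℕ) .{{_ : NonZero b}} .{{_ : NonZero c}}
  (ev₁-f : ev₁ f ≡ + (b ℕ.+ c)) (u : Sequence) (periodic : Periodic P u) (f⋆u : ∀ n → (f ⋆ u) n ≡ + c) where

  F : Poly
  F = gen P u

  f*F : x^ P ⊖1 ∣ᴾ f *ₚ F -ₚ κ (+ c) *ₚ geom P 1
  f*F = ∣-resp (gen-⋆ P f periodic)
    (f *ₚ F +ˡ 𝔸.-‿cong (𝔸.trans (gen-cong P f⋆u) (gen-const P (+ c))))

  ev₁-product : + (b ℕ.+ c) ℤ.* ev₁ F ≡ + c ℤ.* + P
  ev₁-product = begin
    + (b ℕ.+ c) ℤ.* ev₁ F         ≡⟨ cong (ℤ._* ev₁ F) (ev₁-f) ⟨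
    ev₁ f ℤ.* ev₁ F       ≡⟨ ev₁-* f F ⟨
    ev₁ (f *ₚ F)            ≡⟨ ev₁-cong (solve 2 (λ y z → y ⊜ (y ⊕ ⊝ z ⊕ z)) 𝔸.refl (f *ₚ F) (κ (+ c) *ₚ geom P 1)) ⟩
    ev₁ (f *ₚ F -ₚ κ (+ c) *ₚ geom P 1 +ₚ κ (+ c) *ₚ geom P 1)
                                  ≡⟨ ev₁-+ (f *ₚ F -ₚ κ (+ c) *ₚ geom P 1) (κ (+ c) *ₚ geom P 1) ⟩
    ev₁ (f *ₚ F -ₚ κ (+ c) *ₚ geom P 1) ℤ.+ ev₁ (κ (+ c) *ₚ geom P 1)
                                  ≡⟨ cong₂ ℤ._+_ (vanish f*F) (trans (ev₁-* (κ (+ c)) (geom P 1)) (cong₂ ℤ._*_ (ev₁-κ (+ c)) (ev₁-geom P 1))) ⟩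
    0ℤ ℤ.+ + c ℤ.* + P            ≡⟨ ℤₚ.+-identityˡ _ ⟩
    + c ℤ.* + P                   ∎
    where
    open ≡-Reasoning
    vanish : ∀ {f} → x^ P ⊖1 ∣ᴾ f → ev₁ f ≡ 0ℤ
    vanish (q , e) = trans (sym (ev₁-cong e)) (trans (ev₁-* q (x^ P ⊖1)) (trans
      (cong (ev₁ q ℤ.*_) (trans (ev₁-+ (x^ P) (-1ℤ ·ₚ 1ₚ)) (cong (ℤ._+ -1ℤ) (ev₁-x^ P)))) (ℤₚ.*-zeroʳ (ev₁ q))))

  Φ-∣-f*F : ∀ {n} → PrimePower n → n ℕ∣.∣ P → Φ n ∣ᴾ f *ₚ F
  Φ-∣-f*F pn n∣P = ∣-resp (∣-+ (∣ʳ-trans Φ∣x^P⊖1 f*F) (∣-*ˡ (κ (+ c)) Φ∣geom))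
    (solve 2 (λ y z → (y ⊕ ⊝ z ⊕ z) ⊜ y) 𝔸.refl (f *ₚ F) (κ (+ c) *ₚ geom P 1))
    where
    Φ∣geom = Φ-∣-geom pn n∣P
    Φ∣x^P⊖1 : _ ∣ᴾ x^ P ⊖1
    Φ∣x^P⊖1 = ∣-resp (∣-*ˡ x-1 Φ∣geom) (𝔸.trans (*ₚ-comm x-1 (geom P 1))
      (subst (λ m → geom P 1 *ₚ x-1 ≋ x^ m ⊖1) (ℕₚ.*-identityʳ P) (geom-* P 1)))

  Dividing NotDividing : ℕ → Set
  Dividing    n = n ℕ∣.∣ P × (Φ n ∣ₚ f) × PrimePower n
  NotDividing n = n ℕ∣.∣ P × ¬ (Φ n ∣ₚ f) × PrimePower n

  -- Built just like the filter in `S̃`, so that for `f = A l b c` the integer `S` below is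
  -- definitionally the value of `S̃` at 1.
  dividing? : Decidable Dividing
  dividing? n = (n ℕ∣.∣? P) ×-dec (Φ n ∣ₚ? f) ×-dec primePower? n

  notDividing? : Decidable NotDividing
  notDividing? n = (n ℕ∣.∣? P) ×-dec ¬? (Φ n ∣ₚ? f) ×-dec primePower? n

  dividing not-dividing : List ℕ
  dividing     = filter dividing? (upTo (suc P))
  not-dividing = filter notDividing? (upTo (suc P))

  D S : ℤ
  D = ev₁ (∏ₚ (map Φ not-dividing))
  S = ev₁ (∏ₚ (map Φ dividing))

  ∏Φ-∣-F : ∏ₚ (map Φ not-dividing) ∣ᴾ F
  ∏Φ-∣-F = ∏Φ-∣ (Uniqueₚ.filter⁺ notDividing? (Uniqueₚ.upTo⁺ (suc P)))
    (All.tabulate λ n∈ → proj₂ (proj₂ (props n∈)))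
    (All.tabulate λ n∈ → Sum.[ (λ Φ∣f → contradiction (∣⇒∣ₚ Φ∣f) (proj₁ (proj₂ (props n∈)))) , (λ Φ∣F → Φ∣F) ]′
      (Φ-prime (proj₂ (proj₂ (props n∈))) f F (Φ-∣-f*F (proj₂ (proj₂ (props n∈))) (proj₁ (props n∈)))))
    where
    props : ∀ {n} → n ∈ not-dividing → NotDividing n
    props n∈ = proj₂ (∈-filter⁻ notDividing? {xs = upTo (suc P)} n∈)

  P∣SD : + P ℤ∣.∣ S ℤ.* D
  P∣SD = ℤ∣.∣ᵤ⇒∣ (subst (λ z → P ℕ∣.∣ ℤ.∣ z ∣) ev-++ (∏Φ-all-divisors P (dividing ++ not-dividing) all))
    where
    all : ∀ {n} → PrimePower n → n ℕ∣.∣ P → n ∈ dividing ++ not-dividing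
    all {n} pn n∣P = decide (Φ n ∣ₚ? f)
      where
      n∈upTo : n ∈ upTo (suc P)
      n∈upTo = ∈-upTo⁺ (s≤s (ℕ∣.∣⇒≤ n∣P))
      decide : Dec (Φ n ∣ₚ f) → n ∈ dividing ++ not-dividing
      decide (yes d) = ∈-++⁺ˡ (∈-filter⁺ dividing? n∈upTo (n∣P , d , pn))
      decide (no ¬d) = ∈-++⁺ʳ dividing (∈-filter⁺ notDividing? n∈upTo (n∣P , ¬d , pn))
    ∏-++ : ∀ fs gs → ∏ₚ (fs ++ gs) ≋ ∏ₚ fs *ₚ ∏ₚ gs
    ∏-++ []       gs = 𝔸.sym (𝔸.*-identityˡ (∏ₚ gs))
    ∏-++ (f ∷ fs) gs = 𝔸.trans (f *ˡ ∏-++ fs gs) (𝔸.sym (𝔸.*-assoc f (∏ₚ fs) (∏ₚ gs)))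
    ev-++ : ev₁ (∏ₚ (map Φ (dividing ++ not-dividing))) ≡ S ℤ.* D
    ev-++ = trans (cong (ev₁ ∘ ∏ₚ) (map-++ Φ dividing not-dividing))
      (trans (ev₁-cong (∏-++ (map Φ dividing) (map Φ not-dividing))) (ev₁-* (∏ₚ (map Φ dividing)) (∏ₚ (map Φ not-dividing))))

  -- From F(1) = q(1) D and S D = v P it follows that c S D = v c P = v (b + c) q(1) D. Here `D` may
  -- be cancelled, as D = 0 would force c P = 0.
  b+c∣cS : ∏ₚ (map Φ not-dividing) ∣ᴾ F → + P ℤ∣.∣ S ℤ.* D → + (b ℕ.+ c) ℤ∣.∣ + c ℤ.* S
  b+c∣cS (q , F≋) (ℤ∣.divides v SD≡vP) =
    ℤ∣.divides (ev₁ q ℤ.* v) (ℤₚ.*-cancelʳ-≡ (+ c ℤ.* S) (ev₁ q ℤ.* v ℤ.* + (b ℕ.+ c)) D {{ℤ.≢-nonZero D≢0}} (begin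
      + c ℤ.* S ℤ.* D                          ≡⟨ ℤₚ.*-assoc (+ c) S D ⟩
      + c ℤ.* (S ℤ.* D)                        ≡⟨ cong (+ c ℤ.*_) SD≡vP ⟩
      + c ℤ.* (v ℤ.* + P)                      ≡⟨ eq₁ (+ c) v (+ P) ⟩
      v ℤ.* (+ c ℤ.* + P)                      ≡⟨ cong (v ℤ.*_) cP≡ ⟩
      v ℤ.* (+ (b ℕ.+ c) ℤ.* (ev₁ q ℤ.* D))    ≡⟨ eq₂ v (+ (b ℕ.+ c)) (ev₁ q) D ⟩
      ev₁ q ℤ.* v ℤ.* + (b ℕ.+ c) ℤ.* D        ∎))
    where
    open ≡-Reasoning
    eq₁ : ∀ c v P → c ℤ.* (v ℤ.* P) ≡ v ℤ.* (c ℤ.* P)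
    eq₁ = solve-∀
    eq₂ : ∀ v s q D → v ℤ.* (s ℤ.* (q ℤ.* D)) ≡ q ℤ.* v ℤ.* s ℤ.* D
    eq₂ = solve-∀
    cP≡ : + c ℤ.* + P ≡ + (b ℕ.+ c) ℤ.* (ev₁ q ℤ.* D)
    cP≡ = trans (sym ev₁-product) (cong (+ (b ℕ.+ c) ℤ.*_) (trans (sym (ev₁-cong F≋)) (ev₁-* q (∏ₚ (map Φ not-dividing)))))
    D≢0 : D ≢ 0ℤ
    D≢0 D≡0 = contradiction
      (ℤₚ.+-injective (trans (ℤₚ.pos-* c P) (trans cP≡ (trans (cong (λ z → + (b ℕ.+ c) ℤ.* (ev₁ q ℤ.* z)) D≡0)
        (trans (cong (+ (b ℕ.+ c) ℤ.*_) (ℤₚ.*-zeroʳ (ev₁ q))) (ℤₚ.*-zeroʳ (+ (b ℕ.+ c))))))))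
      (ℕ.≢-nonZero⁻¹ (c ℕ.* P) {{ℕₚ.m*n≢0 c P}})

  necessity : + [ b + c ]/gcd ∣ S
  necessity = /gcd-∣⁺ b c (subst (b ℕ.+ c ℕ∣.∣_) (ℤₚ.abs-* (+ c) S) (ℤ∣.∣⇒∣ᵤ (b+c∣cS ∏Φ-∣-F P∣SD)))

-- Sufficiency

∑< : ℕ → Sequence → ℤ
∑< zero    h = 0ℤ
∑< (suc n) h = ∑< n h ℤ.+ h n

∑<-cong : ∀ n {g h : Sequence} → (∀ i → i < n → g i ≡ h i) → ∑< n g ≡ ∑< n h
∑<-cong zero    e = refl
∑<-cong (suc n) e = cong₂ ℤ._+_ (∑<-cong n (λ i i<n → e i (ℕₚ.m<n⇒m<1+n i<n))) (e n (ℕₚ.n<1+n n))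

∑<-+ : ∀ n (g h : Sequence) → ∑< n (λ i → g i ℤ.+ h i) ≡ ∑< n g ℤ.+ ∑< n h
∑<-+ zero    g h = refl
∑<-+ (suc n) g h rewrite ∑<-+ n g h = eq (∑< n g) (∑< n h) (g n) (h n)
  where
  eq : ∀ a b x y → a ℤ.+ b ℤ.+ (x ℤ.+ y) ≡ a ℤ.+ x ℤ.+ (b ℤ.+ y)
  eq = solve-∀

∑<-0 : ∀ n → ∑< n (λ _ → 0ℤ) ≡ 0ℤ
∑<-0 zero    = refl
∑<-0 (suc n) = trans (ℤₚ.+-identityʳ _) (∑<-0 n)

∑<-1 : ∀ n → ∑< n (λ _ → 1ℤ) ≡ + n
∑<-1 zero    = refl
∑<-1 (suc n) = trans (cong (ℤ._+ 1ℤ) (∑<-1 n)) (ℤₚ.+-comm (+ n) 1ℤ)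

∑<-append : ∀ m n h → ∑< (m ℕ.+ n) h ≡ ∑< m h ℤ.+ ∑< n (λ i → h (m ℕ.+ i))
∑<-append m zero    h = trans (cong (λ k → ∑< k h) (ℕₚ.+-identityʳ m)) (sym (ℤₚ.+-identityʳ _))
∑<-append m (suc n) h = trans (cong (λ k → ∑< k h) (ℕₚ.+-suc m n))
  (trans (cong (ℤ._+ h (m ℕ.+ n)) (∑<-append m n h)) (ℤₚ.+-assoc (∑< m h) _ _))

∑<-blocks : ∀ k s h → ∑< s (λ i → ∑< k (λ d → h (i ℕ.+ s ℕ.* d))) ≡ ∑< (k ℕ.* s) h
∑<-blocks zero    s h = ∑<-0 s
∑<-blocks (suc k) s h = begin
  ∑< s (λ i → ∑< k (λ d → h (i ℕ.+ s ℕ.* d)) ℤ.+ h (i ℕ.+ s ℕ.* k))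
    ≡⟨ ∑<-+ s _ _ ⟩
  ∑< s (λ i → ∑< k (λ d → h (i ℕ.+ s ℕ.* d))) ℤ.+ ∑< s (λ i → h (i ℕ.+ s ℕ.* k))
    ≡⟨ cong₂ ℤ._+_ (∑<-blocks k s h) (∑<-cong s λ i _ → cong h (trans (ℕₚ.+-comm i _) (cong (ℕ._+ i) (ℕₚ.*-comm s k)))) ⟩
  ∑< (k ℕ.* s) h ℤ.+ ∑< s (λ i → h (k ℕ.* s ℕ.+ i))
    ≡⟨ ∑<-append (k ℕ.* s) s h ⟨
  ∑< (k ℕ.* s ℕ.+ s) h
    ≡⟨ cong (λ n → ∑< n h) (ℕₚ.+-comm (k ℕ.* s) s) ⟩
  ∑< (s ℕ.+ k ℕ.* s) h ∎
  where open ≡-Reasoning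

∑<-head : ∀ n h → ∑< (suc n) h ≡ h 0 ℤ.+ ∑< n (h ∘ suc)
∑<-head n h = trans (∑<-append 1 n h) (cong (ℤ._+ ∑< n (h ∘ suc)) (ℤₚ.+-identityˡ (h 0)))

∑<-rotate : ∀ n a h → Periodic n h → ∑< n (λ i → h (a ℕ.+ i)) ≡ ∑< n h
∑<-rotate n zero    h per = refl
∑<-rotate n (suc a) h per = trans (∑<-rotate n a (h ∘ suc) (per ∘ suc)) (ℤ-group.∙-cancelˡ (h 0) _ _ (begin
  h 0 ℤ.+ ∑< n (h ∘ suc)   ≡⟨ ∑<-head n h ⟨
  ∑< n h ℤ.+ h n           ≡⟨ ℤₚ.+-comm (∑< n h) (h n) ⟩
  h n ℤ.+ ∑< n h           ≡⟨ cong (ℤ._+ ∑< n h) (per 0) ⟩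
  h 0 ℤ.+ ∑< n h           ∎))
  where open ≡-Reasoning

∑<-rotate-% : ∀ n .{{_ : NonZero n}} a h → ∑< n (λ i → h ((a ℕ.+ i) ℕ/.% n)) ≡ ∑< n h
∑<-rotate-% n a h = trans (∑<-rotate n a (λ i → h (i ℕ/.% n)) (λ i → cong h ([m+n]%n≡m%n i n)))
  (∑<-cong n λ i i<n → cong h (m<n⇒m%n≡m i<n))

∑<-threshold : ∀ {K s} → K ≤ s → (h : Sequence) → (∀ i → i < K → h i ≡ 1ℤ) → (∀ i → K ≤ i → h i ≡ 0ℤ) → ∑< s h ≡ + K
∑<-threshold {K} {s} K≤s h below above = begin
  ∑< s h                                              ≡⟨ cong (λ n → ∑< n h) (ℕₚ.m+[n∸m]≡n K≤s) ⟨
  ∑< (K ℕ.+ (s ∸ K)) h                                ≡⟨ ∑<-append K (s ∸ K) h ⟩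
  ∑< K h ℤ.+ ∑< (s ∸ K) (λ i → h (K ℕ.+ i))           ≡⟨ cong₂ ℤ._+_
    (trans (∑<-cong K below) (∑<-1 K))
    (trans (∑<-cong (s ∸ K) λ i _ → above _ (ℕₚ.m≤m+n K i)) (∑<-0 (s ∸ K))) ⟩
  + K ℤ.+ 0ℤ                                          ≡⟨ ℤₚ.+-identityʳ (+ K) ⟩
  + K                                                 ∎
  where open ≡-Reasoning

geom-⋆ : ∀ k m u n → (geom k m ⋆ u) n ≡ ∑< k (λ d → u (n ℕ.+ d ℕ.* m))
geom-⋆ zero    m u n = refl
geom-⋆ (suc k) m u n = trans (+-⋆ (geom k m) (x^ (k ℕ.* m)) u n) (cong₂ ℤ._+_ (geom-⋆ k m u n) (x^-⋆ (k ℕ.* m) u n))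

-- A labelling of ℕ, periodic modulo P, such that the window f meets each of the
-- labels 0, …, s - 1 exactly once, wherever it is placed.
record Labelling (f : Poly) (P s : ℕ) : Set where
  field
    label    : ℕ → ℕ
    periodic : ∀ n → label (n ℕ.+ P) ≡ label n
    uniform  : ∀ (h : Sequence) n → (f ⋆ (h ∘ label)) n ≡ ∑< s h

  periodic-* : ∀ k n → label (n ℕ.+ k ℕ.* P) ≡ label n
  periodic-* zero    n = cong label (ℕₚ.+-identityʳ n)
  periodic-* (suc k) n = trans (cong label (trans (cong (ℕ._+_ n) (ℕₚ.+-comm P _)) (sym (ℕₚ.+-assoc n _ P))))
    (trans (periodic (n ℕ.+ k ℕ.* P)) (periodic-* k n))

  ev₁-window : ev₁ f ≡ + s
  ev₁-window = trans (ev₁-as-⋆ f) (trans (uniform (λ _ → 1ℤ) 0) (∑<-1 s))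

open Labelling

trivial-labelling : Labelling 1ₚ 1 1
trivial-labelling = record
  { label    = λ _ → 0
  ; periodic = λ _ → refl
  ; uniform  = λ h n → trans (1-⋆ (λ _ → h 0) n) (sym (ℤₚ.+-identityˡ (h 0)))
  }

coarsen : ∀ {f P s} k → Labelling f P s → Labelling f (k ℕ.* P) s
coarsen k L = record { label = label L ; periodic = periodic-* L k ; uniform = uniform L }

-- The label gains the digit ⌊n / P⌋ mod k, which runs through all residues
-- as n runs through n, n + P, …, n + (k - 1) P.
refine : ∀ {f P s} k .{{_ : NonZero k}} .{{_ : NonZero P}} → Labelling f P s → Labelling (geom k P *ₚ f) (k ℕ.* P) (k ℕ.* s)
refine {f} {P} {s} k L = record
  { label    = label′
  ; periodic = λ n → cong₂ (λ x y → x ℕ.+ s ℕ.* y) (periodic-* L k n)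
      (trans (cong (ℕ/._% k) (shift n k)) ([m+n]%n≡m%n (n ℕ/./ P) k))
  ; uniform  = λ h n → begin
      ((geom k P *ₚ f) ⋆ (h ∘ label′)) n
        ≡⟨ *-⋆ (geom k P) f (h ∘ label′) n ⟩
      (geom k P ⋆ f ⋆ (h ∘ label′)) n
        -- With `geom k P` acting innermost, the old label stays fixed while the new digit takes
        -- every value, so the result depends on the position only through `label L`, and
        -- `uniform L` applies.
        ≡⟨ ⋆-comm (geom k P) f (h ∘ label′) n ⟩
      (f ⋆ geom k P ⋆ (h ∘ label′)) n
        ≡⟨ ⋆-congʳ f (λ m → trans (geom-⋆ k P (h ∘ label′) m) (window h m)) n ⟩
      (f ⋆ (λ m → ∑< k (λ d → h (label L m ℕ.+ s ℕ.* d)))) n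
        ≡⟨ uniform L (λ i → ∑< k (λ d → h (i ℕ.+ s ℕ.* d))) n ⟩
      ∑< s (λ i → ∑< k (λ d → h (i ℕ.+ s ℕ.* d)))
        ≡⟨ ∑<-blocks k s h ⟩
      ∑< (k ℕ.* s) h ∎
  }
  where
  open ≡-Reasoning
  label′ : ℕ → ℕ
  label′ n = label L n ℕ.+ s ℕ.* ((n ℕ/./ P) ℕ/.% k)
  shift : ∀ n d → (n ℕ.+ d ℕ.* P) ℕ/./ P ≡ n ℕ/./ P ℕ.+ d
  shift n d = trans (ℕ/.+-distrib-/-∣ʳ n (ℕ∣.n∣m*n d)) (cong (ℕ._+_ (n ℕ/./ P)) (m*n/n≡m d P))
  window : ∀ h m → ∑< k (λ d → h (label′ (m ℕ.+ d ℕ.* P))) ≡ ∑< k (λ d → h (label L m ℕ.+ s ℕ.* d))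
  window h m = trans
    (∑<-cong k λ d _ → cong h (cong₂ (λ x y → x ℕ.+ s ℕ.* y) (periodic-* L d m) (cong (ℕ/._% k) (shift m d))))
    -- The digit at `m` only decides where the cycle of residues starts.
    (∑<-rotate-% k (m ℕ/./ P) (λ d → h (label L m ℕ.+ s ℕ.* d)))

labelling-resp : ∀ {f g P s} → f ≋ g → Labelling f P s → Labelling g P s
labelling-resp {f} {g} e L = record
  { label    = label L
  ; periodic = periodic L
  ; uniform  = λ h n → trans (sym (⋆-congˡ f g (at e) (h ∘ label L) n)) (uniform L h n)
  }

module _ {p : ℕ} (prime-p : Prime p) {R : ℕ → Set} (R? : Decidable R) (¬R0 : ¬ R 0) where
  open PrimePowers prime-p

  -- `R` selects the exponents whose factors occur. A selected exponent adds a digit, any other only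
  -- enlarges the period. Exponent 0 is kept out because x - 1 is not a geometric sum.
  prime-power-labelling : ∀ t → ∃[ s ] Labelling (∏ₚ (map Φ^ (filter R? (downFrom (suc t))))) (p ℕ.^ t) s
  prime-power-labelling zero = 1 , subst (λ is → Labelling (∏ₚ (map Φ^ is)) 1 1) (sym (filter-reject R? ¬R0)) trivial-labelling
  prime-power-labelling (suc t) = extend (prime-power-labelling t) (R? (suc t))
    where
    extend : ∃[ s ] Labelling (∏ₚ (map Φ^ (filter R? (downFrom (suc t))))) (p ℕ.^ t) s → Dec (R (suc t)) →
      ∃[ s ] Labelling (∏ₚ (map Φ^ (filter R? (downFrom (suc (suc t)))))) (p ℕ.* p ℕ.^ t) s
    extend (s , L) (yes r) = p ℕ.* s , subst (λ is → Labelling (∏ₚ (map Φ^ is)) (p ℕ.* p ℕ.^ t) (p ℕ.* s))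
      (sym (filter-accept R? r)) (refine p {{p≢0}} {{p^≢0 {t}}} L)
    extend (s , L) (no ¬r) = s , subst (λ is → Labelling (∏ₚ (map Φ^ is)) (p ℕ.* p ℕ.^ t) s)
      (sym (filter-reject R? ¬r)) (coarsen p L)

-- All divisors of p^t are powers of p, so the product over numbers becomes one over exponents;
-- exponent 0 is absent as 1 is no prime power.
S̃-labelling : ∀ {k p} t (l : Vec ℕ k) b c → Prime p → ∃[ s ] Labelling (S̃ (p ℕ.^ t) l b c) (p ℕ.^ t) s
S̃-labelling {p = p} t l b c prime-p = proj₁ L , labelling-resp (begin
  ∏ₚ (map Φ^ exponents)                  ≈⟨ ∏ₚ-cong {f = Φ^} {xs = exponents} (All.tabulate λ {i} _ → 𝔸.sym (Φ-p^ prime-p i)) ⟩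
  ∏ₚ (map (Φ ∘ (p ℕ.^_)) exponents)      ≡⟨ cong ∏ₚ (map-∘ exponents) ⟩
  ∏ₚ (map Φ (map (p ℕ.^_) exponents))    ≈⟨ ∏ₚ-↭ (↭ₚ.map⁺ Φ (filter-powers-↭ Q? (suc t) powers (λ i<1+t → s≤s (ℕₚ.^-monoʳ-≤ p (ℕ.s≤s⁻¹ i<1+t))))) ⟨
  S̃ P l b c                              ∎) (proj₂ L)
  where
  open ≋-Reasoning
  open PrimePowers prime-p
  P = p ℕ.^ t
  Q : ℕ → Set
  Q n = n ℕ∣.∣ P × (Φ n ∣ₚ A l b c) × PrimePower n
  Q? : Decidable Q
  Q? n = (n ℕ∣.∣? P) ×-dec (Φ n ∣ₚ? A l b c) ×-dec primePower? n
  exponents = filter (λ i → Q? (p ℕ.^ i)) (downFrom (suc t))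
  powers : ∀ {n} → n < suc P → Q n → ∃[ i ] (i < suc t × n ≡ p ℕ.^ i)
  powers _ (n∣P , _) with i , i≤t , e ← ∣p^⇒power prime-p t n∣P = i , s≤s i≤t , e
  ¬Q1 : ¬ Q (p ℕ.^ 0)
  ¬Q1 (_ , _ , q , suc j , qq , _ , e) = contradiction (ℕ∣.∣1⇒≡1 (ℕ∣.divides (q ℕ.^ j) (trans e (ℕₚ.*-comm q (q ℕ.^ j)))))
    (ℕₚ.>⇒≢ (ℕ.nonTrivial⇒n>1 q {{prime⇒nonTrivial qq}}))
  L = prime-power-labelling prime-p (λ i → Q? (p ℕ.^ i)) ¬Q1 t

S̃-∣-A : ∀ {k} P (l : Vec ℕ k) b c → S̃ P l b c ∣ᴾ A l b c
S̃-∣-A P l b c = ∏Φ-∣ (Uniqueₚ.filter⁺ Q? (Uniqueₚ.upTo⁺ (suc P)))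
  (All.tabulate λ n∈ → proj₂ (proj₂ (props n∈)))
  (All.tabulate λ n∈ → ∣ₚ⇒∣ (proj₁ (proj₂ (props n∈))))
  where
  Q : ℕ → Set
  Q n = n ℕ∣.∣ P × (Φ n ∣ₚ A l b c) × PrimePower n
  Q? : Decidable Q
  Q? n = (n ℕ∣.∣? P) ×-dec (Φ n ∣ₚ? A l b c) ×-dec primePower? n
  props : ∀ {n} → n ∈ filter Q? (upTo (suc P)) → Q n
  props n∈ = proj₂ (∈-filter⁻ Q? {xs = upTo (suc P)} n∈)

sufficiency : ∀ {k} P .{{_ : NonZero P}} (l : Vec ℕ k) b c .{{_ : NonZero b}} {s} → Labelling (S̃ P l b c) P s →
  + [ b + c ]/gcd ∣ ev₁ (S̃ P l b c) → HasPerfectColouring (C P l) b c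
sufficiency P l b c {s} L d = from (/gcd-∣⁻ b c (subst (λ z → [ b + c ]/gcd ℕ∣.∣ ℤ.∣ z ∣) (ev₁-window L) d)) (S̃-∣-A P l b c)
  where
  from : b ℕ.+ c ℕ∣.∣ c ℕ.* s → S̃ P l b c ∣ᴾ A l b c → HasPerfectColouring (C P l) b c
  from (ℕ∣.divides K cs≡K[b+c]) (q , A≋) = col , Colouring.⋆⇒perfect P l b c col λ n → begin
    (A l b c ⋆ u) n               ≡⟨ ⋆-congˡ (q *ₚ S̃ P l b c) (A l b c) (at A≋) u n ⟨
    ((q *ₚ S̃ P l b c) ⋆ u) n      ≡⟨ *-⋆ q (S̃ P l b c) u n ⟩
    (q ⋆ S̃ P l b c ⋆ u) n         ≡⟨ ⋆-congʳ q (λ m → trans (⋆-congʳ (S̃ P l b c) u-label m) (trans (uniform L h m) ∑h)) n ⟩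
    (q ⋆ (λ _ → + K)) n           ≡⟨ ⋆-const q (+ K) n ⟩
    ev₁ q ℤ.* + K                 ≡⟨ qK≡c ⟩
    + c                           ∎
    where
    open ≡-Reasoning
    instance
      b+c≢0 : NonZero (b ℕ.+ c)
      b+c≢0 = ℕ.>-nonZero (ℕₚ.<-≤-trans (ℕ.>-nonZero⁻¹ b) (ℕₚ.m≤m+n b c))
    colour : ∀ i → Dec (i < K) → Colour
    colour i (yes _) = black
    colour i (no _)  = white
    h : Sequence
    h i = indicator (colour i (i ℕ.<? K))
    col : Fin P → Colour
    col v = colour (label L (toℕ v)) (label L (toℕ v) ℕ.<? K)
    u = Colouring.colourSequence P l b c col
    u-label : u ≗ h ∘ label L
    u-label n = cong h (trans (cong (label L) (Finₚ.toℕ-fromℕ< _))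
      (trans (sym (periodic-* L (n ℕ/./ P) (n ℕ/.% P))) (cong (label L) (sym (m≡m%n+[m/n]*n n P)))))
    -- From K (b + c) = c s and c ≤ b + c: there are enough labels for the threshold.
    K≤s : K ≤ s
    K≤s = ℕₚ.*-cancelʳ-≤ K s (b ℕ.+ c) (subst₂ _≤_ cs≡K[b+c] (ℕₚ.*-comm (b ℕ.+ c) s) (ℕₚ.*-monoˡ-≤ s (ℕₚ.m≤n+m c b)))
    below : ∀ i → i < K → h i ≡ 1ℤ
    below i i<K with i ℕ.<? K
    ... | yes _  = refl
    ... | no i≮K = contradiction i<K i≮K
    above : ∀ i → K ≤ i → h i ≡ 0ℤ
    above i K≤i with i ℕ.<? K
    ... | yes i<K = contradiction i<K (ℕₚ.≤⇒≯ K≤i)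
    ... | no _    = refl
    ∑h : ∑< s h ≡ + K
    ∑h = ∑<-threshold K≤s h below above
    qs≡b+c : ev₁ q ℤ.* + s ≡ + (b ℕ.+ c)
    qs≡b+c = trans (cong (ev₁ q ℤ.*_) (sym (ev₁-window L))) (trans (sym (ev₁-* q (S̃ P l b c))) (trans (ev₁-cong A≋) (ev₁-A l b c)))
    qK≡c : ev₁ q ℤ.* + K ≡ + c
    qK≡c = ℤₚ.*-cancelʳ-≡ (ev₁ q ℤ.* + K) (+ c) (+ (b ℕ.+ c)) (begin
      ev₁ q ℤ.* + K ℤ.* + (b ℕ.+ c)      ≡⟨ ℤₚ.*-assoc (ev₁ q) (+ K) (+ (b ℕ.+ c)) ⟩
      ev₁ q ℤ.* (+ K ℤ.* + (b ℕ.+ c))    ≡⟨ cong (ev₁ q ℤ.*_) (trans (sym (ℤₚ.pos-* K (b ℕ.+ c))) (trans (cong +_ (sym cs≡K[b+c])) (ℤₚ.pos-* c s))) ⟩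
      ev₁ q ℤ.* (+ c ℤ.* + s)            ≡⟨ eq (ev₁ q) (+ c) (+ s) ⟩
      + c ℤ.* (ev₁ q ℤ.* + s)            ≡⟨ cong (+ c ℤ.*_) qs≡b+c ⟩
      + c ℤ.* + (b ℕ.+ c)                ∎)
      where
      eq : ∀ q c s → q ℤ.* (c ℤ.* s) ≡ c ℤ.* (q ℤ.* s)
      eq = solve-∀

perfect⇒∣ : ∀ {k} P .{{_ : NonZero P}} (l : Vec ℕ k) b c .{{_ : NonZero b}} .{{_ : NonZero c}} →
  HasPerfectColouring (C P l) b c → + [ b + c ]/gcd ∣ ev₁ (S̃ P l b c)
perfect⇒∣ P l b c (col , perfect) = Necessity.necessity P (A l b c) b c (ev₁-A l b c) u
  (λ n → cong (indicator ∘ col) (modFin-cong P _ (+ n) 1ℤ (cong (ℤ._+_ (+ n)) (sym (ℤₚ.*-identityˡ (+ P))))))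
  (Colouring.perfect⇒⋆ P l b c col perfect)
  where u = Colouring.colourSequence P l b c col

theorem1 : (k P : ℕ) .{{_ : NonZero k}} .{{_ : NonZero P}}
    (l : Vec ℕ k) (b c : ℕ) .{{_ : NonZero b}} .{{_ : NonZero c}} →
    (HasPerfectColouring (C P l) b c →
    (+ [ b + c ]/gcd) ∣ eval (S̃ P l b c) 1ℤ)
    ×
    ((q t : ℕ) → Prime q → t > 0 → P ≡ q ^ t →
    HasPerfectColouring (C P l) b c ⇔ ((+ [ b + c ]/gcd) ∣ eval (S̃ P l b c) 1ℤ))
theorem1 k P l b c = perfect⇒∣ P l b c , λ where
  q t prime-q _ refl → mk⇔ (perfect⇒∣ P l b c) (sufficiency P l b c (proj₂ (S̃-labelling t l b c prime-q)))
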